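{- Let $(c_1,\dots,c_m)\in\mathbb{Z}^m$ be a quiddity cycle, with indices read cyclically modulo $m$. Then at least one of the following holds: (0) $m<4$ and $(c_1,\dots,c_m)\in\{(0,0),(1,1,1)\}$. (1) There is $k$ with $c_k=1$ such that $(c_1,\dots,c_{k-2},c_{k-1}-1,c_{k+1}-1,c_{k+2},\dots,c_m)$ is a quiddity cycle of length $m-1$. (2) $m$ is odd and there is $k$ with $c_k=0$ such that $(-c_1,\dots,-c_{k-2},-c_{k-1}-c_{k+1},-c_{k+2},\dots,-c_m)$ is a quiddity cycle of length $m-2$. (3) $m$ is even and there is $k$ with $c_k=-1$ such that $(-c_1,\dots,-c_{k-2},-c_{k-1}-1,-c_{k+1}-1,-c_{k+2},\dots,-c_m)$ is a quiddity cycle of length $m-1$. (4) There are $j,k$, not cyclically adjacent, with $c_j=c_k=0$, and the following sequence is a quiddity cycle of length $m-4$: - if $j$ and $k$ are at cyclic distance greater than $2$: $(c_1,\dots,c_{j-2},c_{j-1}+c_{j+1},c_{j+2},\dots,c_{k-2},c_{k-1}+c_{k+1},c_{k+2},\dots,c_m)$; - if (after possibly swapping $j,k$) $j+1=k-1$: $(c_1,\dots,c_{j-2},c_{j-1}+c_{j+1}+c_{k+1},c_{k+2},\dots,c_m)$. (5) There are $j,k$, not cyclically adjacent, with $c_j=c_k=-1$, and the following sequence is a quiddity cycle of length $m-2$: - if $j$ and $k$ are at cyclic distance greater than $2$: $(c_1,\dots,c_{j-2},c_{j-1}+1,c_{j+1}+1,c_{j+2},\dots,c_{k-2},c_{k-1}+1,c_{k+1}+1,c_{k+2},\dots,c_m)$;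 - if (after possibly swapping $j,k$) $j+1=k-1$: $(c_1,\dots,c_{j-2},c_{j-1}+1,c_{j+1}+2,c_{k+1}+1,c_{k+2},\dots,c_m)$.
   Context: $\eta(c)=\begin{pmatrix}c&-1\\1&0\end{pmatrix}$. A quiddity cycle over $\mathbb{Z}$ is $(c_1,\dots,c_m)\in\mathbb{Z}^m$ with $\eta(c_1)\cdots\eta(c_m)=-I$. -}

module Defs where

open import Data.Fin using (Fin; toℕ)
open import Data.Fin.Properties using (_≟_)
open import Data.Integer using (ℤ; 0ℤ; 1ℤ; -1ℤ; _+_; _*_)
open import Data.List using (List; []; _∷_; length; map; filter; foldr; allFin)
import Data.List.Membership.DecPropositional as Membership
open import Data.Nat as ℕ using (ℕ; suc; _∸_; _⊓_; ∣_-_∣; _<_)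
open import Data.Nat.DivMod using (_mod_)
open import Data.Product using (_×_)
open import Data.Vec.Functional using (Vector; updateAt)
open import Relation.Binary.PropositionalEquality using (_≡_)

infixl 7 _·_
infixl 5 _[_]+=_ _omit_

-- mat a b c d is the matrix with rows (a , b) and (c , d).
record Mat₂ : Set where
  constructor mat
  field
    e₁₁ e₁₂ e₂₁ e₂₂ : ℤ

_·_ : Mat₂ → Mat₂ → Mat₂
mat a b c d · mat a′ b′ c′ d′ =
  mat (a * a′ + b * c′) (a * b′ + b * d′)
      (c * a′ + d * c′) (c * b′ + d * d′)

I -I : Mat₂
I  = mat 1ℤ 0ℤ 0ℤ 1ℤ
-I = mat -1ℤ 0ℤ 0ℤ -1ℤ

η : ℤ → Mat₂
η c = mat c -1ℤ 1ℤ 0ℤ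

IsQuiddityCycle : List ℤ → Set
IsQuiddityCycle cs = foldr (λ c M → η c · M) I cs ≡ -I

IsQuiddityCycleOfLength : ℕ → List ℤ → Set
IsQuiddityCycleOfLength n cs = length cs ≡ n × IsQuiddityCycle cs

-- The indices k + 1 and k - 1 modulo m.
next prev : ∀ {m} → Fin m → Fin m
next {suc n} k = suc (toℕ k) mod suc n
prev {suc n} k = (toℕ k ℕ.+ n) mod suc n

cyclicDistance : ∀ {m} → Fin m → Fin m → ℕ
cyclicDistance {m} j k = ∣ toℕ j - toℕ k ∣ ⊓ (m ∸ ∣ toℕ j - toℕ k ∣)

-- Distance 0 is excluded: j and k are two different positions.
NotCyclicallyAdjacent : ∀ {m} → Fin m → Fin m → Set
NotCyclicallyAdjacent j k = 1 < cyclicDistance j k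

_[_]+=_ : ∀ {m} → Vector ℤ m → Fin m → ℤ → Vector ℤ m
c [ i ]+= x = updateAt c i (_+ x)

-- The entries of c in their original order, without those at the positions ks.
-- A sequence (… , c_{k-2} , c_{k-1} + c_{k+1} , c_{k+2} , …) is rendered by
-- adding c_{k+1} to the entry at position k - 1 and omitting the positions
-- k and k + 1.  Since next and prev wrap around, this also fixes the meaning of
-- such a sequence when k is at either end: every surviving entry keeps its place.
_omit_ : ∀ {m} → Vector ℤ m → List (Fin m) → List ℤ
_omit_ {m} c ks = map c (filter (_∉? ks) (allFin m))
  where open Membership (_≟_ {m}) using (_∉?_)

{-# OPTIONS --safe #-}

-- Since -I is central, all cyclic rotations of a quiddity cycle are quiddity cycles.
-- The local identities η(a) η(ε) η(b) = ε η(a - ε) η(b - ε) for ε = ±1 and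
-- η(a) η(0) η(b) = - η(a + b) shorten the cycle at any entry in {1 , 0 , -1}; a wrong
-- sign is repaired either by negating all entries, when the new length is odd, or by
-- using two such entries that are not adjacent.  Two non-adjacent entries of absolute
-- value < 2 exist when m ≥ 4: if all entries of a sequence have absolute value ≥ 2, then
-- the first column (x , y) of its product satisfies |x| > |y|, so |x| ≥ 2 for a non-empty
-- sequence; but in a quiddity cycle m - 2 consecutive entries have upper left
-- entry 1, and the m - 3 entries not adjacent to c_j have upper left entry c_j.
module Submission where

open import Defs
open import Data.Bool using (true; false; if_then_else_)
open import Data.Fin using (Fin; toℕ)
import Data.Fin as Fin
import Data.Fin.Properties as Finₚ
open import Data.Integer using (ℤ; 0ℤ; 1ℤ; -1ℤ; +_; -[1+_]; _+_; _*_; -_; ∣_∣)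
import Data.Integer.Properties as ℤₚ
open import Data.Integer.Tactic.RingSolver using (solve-∀)
open import Data.List using (List; []; _∷_; _++_; map; filter; foldr; length; tabulate; allFin)
import Data.List.Properties as Listₚ
open import Data.List.Membership.DecPropositional using (_∈?_; _∉?_)
open import Data.List.Membership.Propositional using (_∈_; _∉_)
import Data.List.Membership.Propositional.Properties as ∈ₚ
open import Data.List.Membership.Propositional.Properties.WithK using (unique∧set⇒bag)
open import Data.List.Relation.Binary.BagAndSetEquality using (∼bag⇒↭)
open import Data.List.Relation.Binary.Permutation.Propositional.Properties using (↭-length)
open import Data.List.Relation.Unary.All using ([]; _∷_)
import Data.List.Relation.Unary.All as All
open import Data.List.Relation.Unary.Any using (here; there)
open import Data.List.Relation.Unary.AllPairs using ([]; _∷_)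
open import Data.List.Relation.Unary.Unique.Propositional using (Unique)
import Data.List.Relation.Unary.Unique.Propositional.Properties as Uniqueₚ
open import Data.Maybe using (Maybe; just; nothing)
open import Data.Nat as ℕ using (ℕ; zero; suc; _∸_; _≤_; _<_; z≤n; s≤s; s<s; z<s; parity)
open import Data.Nat.DivMod using (_%_; _mod_; m<n⇒m%n≡m; [m+n]%n≡m%n; %-distribˡ-+; m%n%n≡m%n)
import Data.Nat.Properties as ℕₚ
open import Data.Parity.Base using (Parity; 0ℙ; 1ℙ; _⁻¹)
open import Data.Parity.Properties using (suc-homo-⁻¹; ⁻¹-selfInverse)
open import Data.Product using (_×_; _,_; ∃-syntax; proj₁; proj₂)
open import Data.Sum using (_⊎_; inj₁; inj₂)
open import Data.Vec.Functional using (Vector; toList)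
open import Data.Vec.Functional.Properties using (updateAt-updates; updateAt-minimal; updateAt-updateAt-local)
open import Function using (_∘_; id; mk⇔)
open import Relation.Binary.PropositionalEquality
  using (_≡_; _≢_; _≗_; refl; sym; trans; cong; cong₂; subst; module ≡-Reasoning)
open import Relation.Nullary using (yes; no; contradiction; does)
open import Relation.Nullary.Decidable using (dec-true; dec-false)

open Mat₂

private variable
  n : ℕ
  s : ℤ

-- Integer two-by-two matrices and central scalars.

mat-cong : ∀ {a b c d a′ b′ c′ d′} → a ≡ a′ → b ≡ b′ → c ≡ c′ → d ≡ d′ →
           mat a b c d ≡ mat a′ b′ c′ d′
mat-cong refl refl refl refl = refl

·-assoc : ∀ A B C → A · B · C ≡ A · (B · C)
·-assoc (mat a b c d) (mat p q u v) (mat x y z w) =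
  mat-cong (entry a b p q u v x z) (entry a b p q u v y w)
           (entry c d p q u v x z) (entry c d p q u v y w)
  where
  entry : ∀ a b p q u v x z →
          (a * p + b * u) * x + (a * q + b * v) * z ≡
          a * (p * x + q * z) + b * (u * x + v * z)
  entry = solve-∀

·-identityˡ : ∀ A → I · A ≡ A
·-identityˡ (mat a b c d) = mat-cong (top a c) (top b d) (bottom a c) (bottom b d)
  where
  top : ∀ x y → 1ℤ * x + 0ℤ * y ≡ x
  top = solve-∀
  bottom : ∀ x y → 0ℤ * x + 1ℤ * y ≡ y
  bottom = solve-∀

·-identityʳ : ∀ A → A · I ≡ A
·-identityʳ (mat a b c d) = mat-cong (left a b) (right a b) (left c d) (right c d)
  where
  left : ∀ x y → x * 1ℤ + y * 0ℤ ≡ x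
  left = solve-∀
  right : ∀ x y → x * 0ℤ + y * 1ℤ ≡ y
  right = solve-∀

scalar : ℤ → Mat₂
scalar s = mat s 0ℤ 0ℤ s

scalar-central : ∀ s A → A · scalar s ≡ scalar s · A
scalar-central s (mat a b c d) =
  mat-cong (e₁ s a b c) (e₂ s a b d) (e₃ s c d a) (e₄ s c d b)
  where
  e₁ : ∀ s a b c → a * s + b * 0ℤ ≡ s * a + 0ℤ * c
  e₁ = solve-∀
  e₂ : ∀ s a b d → a * 0ℤ + b * s ≡ s * b + 0ℤ * d
  e₂ = solve-∀
  e₃ : ∀ s c d a → c * s + d * 0ℤ ≡ 0ℤ * a + s * c
  e₃ = solve-∀
  e₄ : ∀ s c d b → c * 0ℤ + d * s ≡ 0ℤ * b + s * d
  e₄ = solve-∀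

scalar-· : ∀ s t → scalar s · scalar t ≡ scalar (s * t)
scalar-· s t = mat-cong (diag s t) (off s t) (off′ s t) (diag′ s t)
  where
  diag : ∀ s t → s * t + 0ℤ * 0ℤ ≡ s * t
  diag = solve-∀
  off : ∀ s t → s * 0ℤ + 0ℤ * t ≡ 0ℤ
  off = solve-∀
  off′ : ∀ s t → 0ℤ * t + s * 0ℤ ≡ 0ℤ
  off′ = solve-∀
  diag′ : ∀ s t → 0ℤ * 0ℤ + s * t ≡ s * t
  diag′ = solve-∀

·-middle-scalar : ∀ A s B → A · (scalar s · B) ≡ scalar s · (A · B)
·-middle-scalar A s B = begin
  A · (scalar s · B) ≡⟨ ·-assoc A (scalar s) B ⟨
  A · scalar s · B   ≡⟨ cong (_· B) (scalar-central s A) ⟩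
  scalar s · A · B   ≡⟨ ·-assoc (scalar s) A B ⟩
  scalar s · (A · B) ∎
  where open ≡-Reasoning

-- Words with omitted letters and their products over windows.

-- Omitted positions of a sequence are kept as the letter nothing, so that all
-- the sequences that occur are indexed by the same cyclic group.
factor : Maybe ℤ → Mat₂
factor (just c) = η c
factor nothing  = I

factor⁻¹ : Maybe ℤ → Mat₂
factor⁻¹ (just c) = mat 0ℤ 1ℤ -1ℤ c
factor⁻¹ nothing  = I

factor-inverseˡ : ∀ x → factor⁻¹ x · factor x ≡ I
factor-inverseˡ nothing  = refl
factor-inverseˡ (just c) = mat-cong (e₁ c) (e₂ c) (e₃ c) (e₄ c)
  where
  e₁ : ∀ c → 0ℤ * c + 1ℤ * 1ℤ ≡ 1ℤ
  e₁ = solve-∀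
  e₂ : ∀ (c : ℤ) → 0ℤ * -1ℤ + 1ℤ * 0ℤ ≡ 0ℤ
  e₂ = solve-∀
  e₃ : ∀ c → -1ℤ * c + c * 1ℤ ≡ 0ℤ
  e₃ = solve-∀
  e₄ : ∀ c → -1ℤ * -1ℤ + c * 0ℤ ≡ 1ℤ
  e₄ = solve-∀

factor-inverseʳ : ∀ x → factor x · factor⁻¹ x ≡ I
factor-inverseʳ nothing  = refl
factor-inverseʳ (just c) = mat-cong (e₁ c) (e₂ c) (e₃ c) (e₄ c)
  where
  e₁ : ∀ c → c * 0ℤ + -1ℤ * -1ℤ ≡ 1ℤ
  e₁ = solve-∀
  e₂ : ∀ c → c * 1ℤ + -1ℤ * c ≡ 0ℤ
  e₂ = solve-∀
  e₃ : ∀ (c : ℤ) → 1ℤ * 0ℤ + 0ℤ * -1ℤ ≡ 0ℤ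
  e₃ = solve-∀
  e₄ : ∀ c → 1ℤ * 1ℤ + 0ℤ * c ≡ 1ℤ
  e₄ = solve-∀

-- Cancelling A on the left turns A M = s into M = s B, and s is central. This is what allows the
-- first factor of a cyclic product to be moved to its end.
·-inverses-commute : ∀ A B M {s} → B · A ≡ I → A · M ≡ scalar s → M · A ≡ scalar s
·-inverses-commute A B M {s} BA≡I AM≡s = begin
  M · A               ≡⟨ cong (_· A) M≡ ⟩
  scalar s · B · A    ≡⟨ ·-assoc (scalar s) B A ⟩
  scalar s · (B · A)  ≡⟨ cong (scalar s ·_) BA≡I ⟩
  scalar s · I        ≡⟨ ·-identityʳ _ ⟩
  scalar s            ∎
  where
  open ≡-Reasoning
  M≡ : M ≡ scalar s · B
  M≡ = begin
    M            ≡⟨ ·-identityˡ M ⟨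
    I · M        ≡⟨ cong (_· M) BA≡I ⟨
    B · A · M    ≡⟨ ·-assoc B A M ⟩
    B · (A · M)  ≡⟨ cong (B ·_) AM≡s ⟩
    B · scalar s ≡⟨ scalar-central s B ⟩
    scalar s · B ∎

·-inverses-commute′ : ∀ A B M {s} → A · B ≡ I → M · A ≡ scalar s → A · M ≡ scalar s
·-inverses-commute′ A B M {s} AB≡I MA≡s = begin
  A · M               ≡⟨ cong (A ·_) M≡ ⟩
  A · (scalar s · B)  ≡⟨ ·-middle-scalar A s B ⟩
  scalar s · (A · B)  ≡⟨ cong (scalar s ·_) AB≡I ⟩
  scalar s · I        ≡⟨ ·-identityʳ _ ⟩
  scalar s            ∎
  where
  open ≡-Reasoning
  M≡ : M ≡ scalar s · B
  M≡ = begin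
    M            ≡⟨ ·-identityʳ M ⟨
    M · I        ≡⟨ cong (M ·_) AB≡I ⟨
    M · (A · B)  ≡⟨ ·-assoc M A B ⟨
    M · A · B    ≡⟨ cong (_· B) MA≡s ⟩
    scalar s · B ∎

-- The word is a function on all of ℕ, later made periodic by `pos`, so that a window running past
-- the end needs no separate treatment.
∏ : (ℕ → Maybe ℤ) → ℕ → ℕ → Mat₂
∏ w a zero    = I
∏ w a (suc r) = factor (w a) · ∏ w (suc a) r

∏-cong : ∀ {w w′} a r → (∀ i → i < r → w (i ℕ.+ a) ≡ w′ (i ℕ.+ a)) → ∏ w a r ≡ ∏ w′ a r
∏-cong a zero    eq = refl
∏-cong {w} {w′} a (suc r) eq = cong₂ (λ x M → factor x · M) (eq 0 z<s)
  (∏-cong (suc a) r λ i i<r →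
    subst (λ t → w t ≡ w′ t) (sym (ℕₚ.+-suc i a)) (eq (suc i) (s<s i<r)))

∏-snoc : ∀ w a r → ∏ w a (suc r) ≡ ∏ w a r · factor (w (r ℕ.+ a))
∏-snoc w a zero    = trans (·-identityʳ (factor (w a))) (sym (·-identityˡ (factor (w a))))
∏-snoc w a (suc r) = begin
  factor (w a) · ∏ w (suc a) (suc r)
    ≡⟨ cong (factor (w a) ·_) (∏-snoc w (suc a) r) ⟩
  factor (w a) · (∏ w (suc a) r · factor (w (r ℕ.+ suc a)))
    ≡⟨ ·-assoc (factor (w a)) (∏ w (suc a) r) _ ⟨
  ∏ w a (suc r) · factor (w (r ℕ.+ suc a))
    ≡⟨ cong (λ t → ∏ w a (suc r) · factor (w t)) (ℕₚ.+-suc r a) ⟩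
  ∏ w a (suc r) · factor (w (suc r ℕ.+ a)) ∎
  where open ≡-Reasoning

-- Arithmetic of cyclic positions.

pos : ℕ → Fin (suc n)
pos {n} t = t mod suc n

toℕ-pos : ∀ t → toℕ (pos {n} t) ≡ t % suc n
toℕ-pos t = Finₚ.toℕ-fromℕ< _

%⇒pos : ∀ {i : Fin (suc n)} {t} → toℕ i ≡ t % suc n → i ≡ pos t
%⇒pos {n} {t = t} eq = Finₚ.toℕ-injective (trans eq (sym (toℕ-pos t)))

pos-toℕ : (i : Fin (suc n)) → pos (toℕ i) ≡ i
pos-toℕ i = sym (%⇒pos {t = toℕ i} (sym (m<n⇒m%n≡m (Finₚ.toℕ<n i))))

pos-period : ∀ t → pos {n} (t ℕ.+ suc n) ≡ pos t
pos-period {n} t = %⇒pos {t = t} (trans (toℕ-pos (t ℕ.+ suc n)) ([m+n]%n≡m%n t (suc n)))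

pos-+ : ∀ s t → pos {n} (s ℕ.+ toℕ (pos {n} t)) ≡ pos (s ℕ.+ t)
pos-+ {n} s t = %⇒pos {t = s ℕ.+ t} (begin
  toℕ (pos (s ℕ.+ toℕ (pos {n} t)))              ≡⟨ toℕ-pos (s ℕ.+ toℕ (pos {n} t)) ⟩
  (s ℕ.+ toℕ (pos {n} t)) % M                    ≡⟨ cong (λ x → (s ℕ.+ x) % M) (toℕ-pos t) ⟩
  (s ℕ.+ t % M) % M                              ≡⟨ %-distribˡ-+ s (t % M) M ⟩
  (s % M ℕ.+ t % M % M) % M                      ≡⟨ cong (λ x → (s % M ℕ.+ x) % M) (m%n%n≡m%n t M) ⟩
  (s % M ℕ.+ t % M) % M                          ≡⟨ %-distribˡ-+ s t M ⟨
  (s ℕ.+ t) % M                                  ∎)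
  where
  open ≡-Reasoning
  M = suc n

next-pos : ∀ t → next (pos {n} t) ≡ pos (suc t)
next-pos t = pos-+ 1 t

prev-pos : ∀ t → prev (pos {n} (suc t)) ≡ pos t
prev-pos {n} t = begin
  pos (toℕ (pos {n} (suc t)) ℕ.+ n) ≡⟨ cong pos (ℕₚ.+-comm (toℕ (pos {n} (suc t))) n) ⟩
  pos (n ℕ.+ toℕ (pos {n} (suc t))) ≡⟨ pos-+ n (suc t) ⟩
  pos (n ℕ.+ suc t)                 ≡⟨ cong pos (trans (ℕₚ.+-comm n (suc t)) (sym (ℕₚ.+-suc t n))) ⟩
  pos (t ℕ.+ suc n)                 ≡⟨ pos-period t ⟩
  pos t                             ∎
  where open ≡-Reasoning

-- Since n is -1 modulo n + 1, the number `toℕ k ℕ.+ n` represents the position before k without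
-- truncated subtraction.
pos-centre : (k : Fin (suc n)) → pos (suc (toℕ k ℕ.+ n)) ≡ k
pos-centre {n} k =
  trans (cong pos (sym (ℕₚ.+-suc (toℕ k) n))) (trans (pos-period (toℕ k)) (pos-toℕ k))

pos-next : (k : Fin (suc n)) → pos (suc (suc (toℕ k ℕ.+ n))) ≡ next k
pos-next {n} k = trans (sym (next-pos (suc (toℕ k ℕ.+ n)))) (cong next (pos-centre k))

-- Both summands are below the length, so their sum wraps around at most once. The second
-- alternative is that one wrap, with the length added on the left instead of subtracted on the
-- right.
pos-offset : ∀ e t → e < suc n →
  toℕ (pos {n} (e ℕ.+ t)) ≡ e ℕ.+ toℕ (pos {n} t) ⊎
  suc n ℕ.+ toℕ (pos {n} (e ℕ.+ t)) ≡ e ℕ.+ toℕ (pos {n} t)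
pos-offset {n} e t e<m with e ℕ.+ toℕ (pos {n} t) ℕ.<? suc n
... | yes y<m = inj₁ (begin
  toℕ (pos {n} (e ℕ.+ t))               ≡⟨ cong toℕ (pos-+ e t) ⟨
  toℕ (pos {n} (e ℕ.+ toℕ (pos {n} t))) ≡⟨ toℕ-pos (e ℕ.+ toℕ (pos {n} t)) ⟩
  (e ℕ.+ toℕ (pos {n} t)) % suc n       ≡⟨ m<n⇒m%n≡m y<m ⟩
  e ℕ.+ toℕ (pos {n} t)                 ∎)
  where open ≡-Reasoning
... | no y≮m = inj₂ (begin
  suc n ℕ.+ toℕ (pos {n} (e ℕ.+ t)) ≡⟨ cong (λ i → suc n ℕ.+ toℕ i) (pos-+ e t) ⟨
  suc n ℕ.+ toℕ (pos {n} y)         ≡⟨ cong (suc n ℕ.+_) (toℕ-pos y) ⟩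
  suc n ℕ.+ y % suc n               ≡⟨ cong (λ x → suc n ℕ.+ x % suc n) y≡ ⟩
  suc n ℕ.+ (z ℕ.+ suc n) % suc n   ≡⟨ cong (suc n ℕ.+_) ([m+n]%n≡m%n z (suc n)) ⟩
  suc n ℕ.+ z % suc n               ≡⟨ cong (suc n ℕ.+_) (m<n⇒m%n≡m z<m) ⟩
  suc n ℕ.+ z                       ≡⟨ ℕₚ.+-comm (suc n) z ⟩
  z ℕ.+ suc n                       ≡⟨ y≡ ⟨
  y                                 ∎)
  where
  open ≡-Reasoning
  y = e ℕ.+ toℕ (pos {n} t)
  z = y ∸ suc n
  y≡ : y ≡ z ℕ.+ suc n
  y≡ = sym (ℕₚ.m∸n+n≡m (ℕₚ.≮⇒≥ y≮m))
  z<m : z < suc n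
  z<m = ℕₚ.+-cancelʳ-< (suc n) z (suc n)
    (subst (_< suc n ℕ.+ suc n) y≡ (ℕₚ.+-mono-< e<m (Finₚ.toℕ<n (pos {n} t))))

-- The offset e = y - x lies strictly between 0 and the length. If the positions agreed,
-- `pos-offset` would force e to be 0 or the full length.
pos-≢ : ∀ {x y} b → x < y → y < suc n → pos {n} (x ℕ.+ b) ≢ pos (y ℕ.+ b)
pos-≢ {n} {x} {y} b x<y y<m eq = case (pos-offset e (x ℕ.+ b) e<m)
  where
  e = y ∸ x
  e<m : e < suc n
  e<m = ℕₚ.≤-<-trans (ℕₚ.m∸n≤m y x) y<m
  p = toℕ (pos {n} (x ℕ.+ b))
  p≡ : toℕ (pos {n} (e ℕ.+ (x ℕ.+ b))) ≡ p
  p≡ = cong toℕ (trans (cong pos (trans (sym (ℕₚ.+-assoc e x b))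
         (cong (ℕ._+ b) (ℕₚ.m∸n+n≡m (ℕₚ.<⇒≤ x<y))))) (sym eq))
  case : toℕ (pos {n} (e ℕ.+ (x ℕ.+ b))) ≡ e ℕ.+ p ⊎
         suc n ℕ.+ toℕ (pos {n} (e ℕ.+ (x ℕ.+ b))) ≡ e ℕ.+ p → _
  case (inj₁ p≡e+p) =
    ℕₚ.<⇒≢ (ℕₚ.m<n⇒0<n∸m x<y) (ℕₚ.+-cancelʳ-≡ p 0 e (trans (sym p≡) p≡e+p))
  case (inj₂ m+p≡e+p) =
    ℕₚ.<⇒≢ e<m (sym (ℕₚ.+-cancelʳ-≡ p (suc n) e (trans (cong (suc n ℕ.+_) (sym p≡)) m+p≡e+p)))

-- For positions at offset e the difference of the representatives is e or m - e, where m is the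
-- length, and the two hypotheses say that both of these exceed d.
cyclicDistance-> : ∀ {d} e t → d < e → d ℕ.+ e < suc n →
                   d < cyclicDistance (pos {n} t) (pos (e ℕ.+ t))
cyclicDistance-> {n} {d} e t d<e d+e<m = ℕₚ.⊓-glb d<∣x-y∣ d<m-∣x-y∣
  where
  e<m : e < suc n
  e<m = ℕₚ.≤-<-trans (ℕₚ.m≤n+m e d) d+e<m
  x = toℕ (pos {n} t)
  y = toℕ (pos {n} (e ℕ.+ t))
  d<m∸e : d < suc n ∸ e
  d<m∸e = ℕₚ.+-cancelʳ-< e d (suc n ∸ e)
    (subst (d ℕ.+ e <_) (sym (ℕₚ.m∸n+n≡m (ℕₚ.<⇒≤ e<m))) d+e<m)
  dist : ℕ.∣ x - y ∣ ≡ e ⊎ ℕ.∣ x - y ∣ ≡ suc n ∸ e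
  dist with pos-offset e t e<m
  ... | inj₁ y≡e+x = inj₁ (trans (cong ℕ.∣ x -_∣ (trans y≡e+x (ℕₚ.+-comm e x))) (ℕₚ.∣m-m+n∣≡n x e))
  ... | inj₂ m+y≡e+x = inj₂ (trans (cong ℕ.∣_- y ∣ x≡)
    (trans (ℕₚ.∣-∣-comm (y ℕ.+ (suc n ∸ e)) y) (ℕₚ.∣m-m+n∣≡n y (suc n ∸ e))))
    where
    open ≡-Reasoning
    x≡ : x ≡ y ℕ.+ (suc n ∸ e)
    x≡ = ℕₚ.+-cancelˡ-≡ e x _ (begin
      e ℕ.+ x                     ≡⟨ m+y≡e+x ⟨
      suc n ℕ.+ y                 ≡⟨ cong (ℕ._+ y) (ℕₚ.m+[n∸m]≡n (ℕₚ.<⇒≤ e<m)) ⟨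
      e ℕ.+ (suc n ∸ e) ℕ.+ y     ≡⟨ ℕₚ.+-assoc e (suc n ∸ e) y ⟩
      e ℕ.+ (suc n ∸ e ℕ.+ y)     ≡⟨ cong (e ℕ.+_) (ℕₚ.+-comm (suc n ∸ e) y) ⟩
      e ℕ.+ (y ℕ.+ (suc n ∸ e))   ∎)
  d<∣x-y∣ : d < ℕ.∣ x - y ∣
  d<∣x-y∣ with dist
  ... | inj₁ eq = subst (d <_) (sym eq) d<e
  ... | inj₂ eq = subst (d <_) (sym eq) d<m∸e
  d<m-∣x-y∣ : d < suc n ∸ ℕ.∣ x - y ∣
  d<m-∣x-y∣ with dist
  ... | inj₁ eq = subst (λ z → d < suc n ∸ z) (sym eq) d<m∸e
  ... | inj₂ eq = subst (λ z → d < suc n ∸ z) (sym eq)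
        (subst (d <_) (sym (ℕₚ.m∸[m∸n]≡n (ℕₚ.<⇒≤ e<m))) d<e)

-- Cyclic words with scalar product: rotation and local replacement.

-- The scalar is left open because a contraction at 0 or -1 flips its sign; the sign is restored by
-- a second contraction or by negating all entries.
record Balanced {n} (s : ℤ) (u : Fin (suc n) → Maybe ℤ) : Set where
  constructor balanced
  field
    ∏≡scalar : ∏ (u ∘ pos) 0 (suc n) ≡ scalar s

open Balanced

Balanced-cong : ∀ {u v : Fin (suc n) → Maybe ℤ} → u ≗ v → Balanced s u → Balanced s v
Balanced-cong {n} {u = u} {v} u≗v (balanced eq) =
  balanced (trans (∏-cong {v ∘ pos} {u ∘ pos} 0 (suc n) λ i _ → sym (u≗v (pos (i ℕ.+ 0)))) eq)

module _ (u : Fin (suc n) → Maybe ℤ) where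

  private
    w = u ∘ pos
    snoc : ∀ a → ∏ w (suc a) (suc n) ≡ ∏ w (suc a) n · factor (w a)
    snoc a = trans (∏-snoc w (suc a) n) (cong (λ i → ∏ w (suc a) n · factor (u i))
      (trans (cong pos (trans (ℕₚ.+-comm n (suc a)) (sym (ℕₚ.+-suc a n)))) (pos-period a)))

  -- Shifting the start by one conjugates the product by its first letter, and conjugation fixes
  -- scalars.
  rotate : ∀ a → ∏ w 0 (suc n) ≡ scalar s → ∏ w a (suc n) ≡ scalar s
  rotate zero    eq = eq
  rotate (suc a) eq = trans (snoc a)
    (·-inverses-commute (factor (w a)) (factor⁻¹ (w a)) (∏ w (suc a) n)
      (factor-inverseˡ (w a)) (rotate a eq))

  unrotate : ∀ a → ∏ w a (suc n) ≡ scalar s → ∏ w 0 (suc n) ≡ scalar s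
  unrotate zero    eq = eq
  unrotate (suc a) eq = unrotate a
    (·-inverses-commute′ (factor (w a)) (factor⁻¹ (w a)) (∏ w (suc a) n)
      (factor-inverseʳ (w a)) (trans (sym (snoc a)) eq))

-- Rotation brings the three letters around k to the front; there they are exchanged, and the factor
-- σ is multiplied into the scalar. The length is at least 3, so the window does not overlap itself.
replace-window : ∀ {u v : Fin (suc n) → Maybe ℤ} {σ} k → 2 ≤ n →
  (∀ i → i ≢ prev k → i ≢ k → i ≢ next k → v i ≡ u i) →
  factor (v (prev k)) · (factor (v k) · factor (v (next k))) ≡
    scalar σ · (factor (u (prev k)) · (factor (u k) · factor (u (next k)))) →
  Balanced s u → Balanced (σ * s) v
replace-window {suc zero} k (s≤s ())
replace-window {suc (suc n)} {s} {u} {v} {σ} k 2≤n agree window (balanced eq) = balanced (unrotate v t (begin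
  V₀ · (V₁ · (V₂ · ∏ (v ∘ pos) (3 ℕ.+ t) n))
    ≡⟨ regroup V₀ V₁ V₂ _ ⟩
  V₀ · (V₁ · V₂) · ∏ (v ∘ pos) (3 ℕ.+ t) n
    ≡⟨ cong₂ _·_ window′ rest ⟩
  scalar σ · (U₀ · (U₁ · U₂)) · ∏ (u ∘ pos) (3 ℕ.+ t) n
    ≡⟨ ·-assoc (scalar σ) _ _ ⟩
  scalar σ · (U₀ · (U₁ · U₂) · ∏ (u ∘ pos) (3 ℕ.+ t) n)
    ≡⟨ cong (scalar σ ·_) (regroup U₀ U₁ U₂ _) ⟨
  scalar σ · ∏ (u ∘ pos) t (3 ℕ.+ n)
    ≡⟨ cong (scalar σ ·_) (rotate u t eq) ⟩
  scalar σ · scalar s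
    ≡⟨ scalar-· σ s ⟩
  scalar (σ * s) ∎))
  where
  open ≡-Reasoning
  t = toℕ k ℕ.+ suc (suc n)
  pos₁ : pos (suc t) ≡ k
  pos₁ = pos-centre k
  pos₂ : pos (suc (suc t)) ≡ next k
  pos₂ = pos-next k
  U₀ = factor (u (pos t))
  U₁ = factor (u (pos (suc t)))
  U₂ = factor (u (pos (suc (suc t))))
  V₀ = factor (v (pos t))
  V₁ = factor (v (pos (suc t)))
  V₂ = factor (v (pos (suc (suc t))))
  window′ : V₀ · (V₁ · V₂) ≡ scalar σ · (U₀ · (U₁ · U₂))
  window′ rewrite pos₁ | pos₂ = window
  regroup : ∀ A B C D → A · (B · (C · D)) ≡ A · (B · C) · D
  regroup A B C D = trans (cong (A ·_) (sym (·-assoc B C D))) (sym (·-assoc A (B · C) D))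
  outside : ∀ {x i} → x < 3 → i < n → pos (i ℕ.+ (3 ℕ.+ t)) ≢ pos {suc (suc n)} (x ℕ.+ t)
  outside {x} {i} x<3 i<n eq = pos-≢ t (ℕₚ.≤-trans x<3 (ℕₚ.m≤n+m 3 i))
    (subst (i ℕ.+ 3 <_) (ℕₚ.+-comm n 3) (ℕₚ.+-monoˡ-< 3 i<n))
    (sym (trans (cong pos (ℕₚ.+-assoc i 3 t)) eq))
  rest : ∏ (v ∘ pos) (3 ℕ.+ t) n ≡ ∏ (u ∘ pos) (3 ℕ.+ t) n
  rest = ∏-cong (3 ℕ.+ t) n λ i i<n → agree _
    (outside {0} z<s i<n)
    (λ eq → outside {1} (s<s z<s) i<n (trans eq (sym pos₁)))
    (λ eq → outside {2} (s<s (s<s z<s)) i<n (trans eq (sym pos₂)))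

-- From lists with omitted positions to cyclic words and back.

infix 4 _∈ᶠ?_ _∉ᶠ?_
_∈ᶠ?_ = λ {m} → _∈?_ (Finₚ._≟_ {m})
_∉ᶠ?_ = λ {m} → _∉?_ (Finₚ._≟_ {m})

-- The decision is the one by which `omit` filters, so a single case split in `η∏-filter` settles
-- both sides.
masked : ∀ {m} → Vector ℤ m → List (Fin m) → Fin m → Maybe ℤ
masked c ks i = if does (i ∉ᶠ? ks) then just (c i) else nothing

masked-∉ : ∀ {m} (c : Vector ℤ m) {ks i} → i ∉ ks → masked c ks i ≡ just (c i)
masked-∉ c {ks} {i} i∉ks rewrite dec-true (i ∉ᶠ? ks) i∉ks = refl

masked-∈ : ∀ {m} (c : Vector ℤ m) {ks i} → i ∈ ks → masked c ks i ≡ nothing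
masked-∈ c {ks} {i} i∈ks rewrite dec-false (i ∉ᶠ? ks) (λ i∉ks → i∉ks i∈ks) = refl

masked-cong : ∀ {m} (c c′ : Vector ℤ m) {ks ks′ i} → (i ∈ ks → i ∈ ks′) → (i ∈ ks′ → i ∈ ks) →
              (i ∉ ks → c i ≡ c′ i) → masked c ks i ≡ masked c′ ks′ i
masked-cong c c′ {ks} {ks′} {i} ⊆ ⊇ eq with i ∈ᶠ? ks
... | yes i∈ks = sym (masked-∈ c′ (⊆ i∈ks))
... | no  i∉ks = trans (cong just (eq i∉ks)) (sym (masked-∉ c′ (i∉ks ∘ ⊇)))

η∏ : List ℤ → Mat₂
η∏ = foldr (λ c M → η c · M) I

-- A letter `nothing` contributes the identity matrix, so deleting a position and masking it give
-- the same product.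
η∏-omit : (c : Vector ℤ (suc n)) (ks : List (Fin (suc n))) →
          η∏ (c omit ks) ≡ ∏ (masked c ks ∘ pos) 0 (suc n)
η∏-omit {n} c ks = trans (η∏-filter (allFin (suc n)))
  (foldr-tabulate (suc n) 0 id λ i → sym (trans (cong pos (ℕₚ.+-identityʳ (toℕ i))) (pos-toℕ i)))
  where
  step : Fin (suc n) → Mat₂ → Mat₂
  step i M = factor (masked c ks i) · M
  η∏-filter : ∀ is → η∏ (map c (filter (_∉ᶠ? ks) is)) ≡ foldr step I is
  η∏-filter []       = refl
  η∏-filter (i ∷ is) with does (i ∈ᶠ? ks)
  ... | false = cong (η (c i) ·_) (η∏-filter is)
  ... | true  = trans (η∏-filter is) (sym (·-identityˡ (foldr step I is)))
  foldr-tabulate : ∀ r a (g : Fin r → Fin (suc n)) → (∀ i → g i ≡ pos (toℕ i ℕ.+ a)) →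
                   foldr step I (tabulate g) ≡ ∏ (masked c ks ∘ pos) a r
  foldr-tabulate zero    a g eq = refl
  foldr-tabulate (suc r) a g eq = cong₂ step (eq Fin.zero)
    (foldr-tabulate r (suc a) (g ∘ Fin.suc) λ i →
      trans (eq (Fin.suc i)) (cong pos (sym (ℕₚ.+-suc (toℕ i) a))))

omit-[] : ∀ {m} (c : Vector ℤ m) → c omit [] ≡ toList c
omit-[] {m} c = trans
  (cong (map c) (Listₚ.filter-all (_∉ᶠ? []) {allFin m} (All.universal (λ _ ()) (allFin m))))
  (Listₚ.map-tabulate id c)

quiddity⇒Balanced : (c : Vector ℤ (suc n)) → IsQuiddityCycle (toList c) →
                    Balanced -1ℤ (masked c [])
quiddity⇒Balanced c q = balanced (trans (sym (η∏-omit c [])) (trans (cong η∏ (omit-[] c)) q))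

-- The omitted positions followed by the surviving ones form a duplicate-free list with the same
-- members as `allFin m`, hence a permutation of it.
length-omit : ∀ {m} (c : Vector ℤ m) {ks} → Unique ks → length (c omit ks) ≡ m ∸ length ks
length-omit {m} c {ks} uniq = begin
  length (map c rest)                    ≡⟨ Listₚ.length-map c rest ⟩
  length rest                            ≡⟨ ℕₚ.m+n∸m≡n (length ks) (length rest) ⟨
  length ks ℕ.+ length rest ∸ length ks  ≡⟨ cong (_∸ length ks) (Listₚ.length-++ ks) ⟨
  length (ks ++ rest) ∸ length ks        ≡⟨ cong (_∸ length ks) (↭-length (∼bag⇒↭ bag)) ⟩
  length (allFin m) ∸ length ks          ≡⟨ cong (_∸ length ks) (Listₚ.length-tabulate {n = m} id) ⟩
  m ∸ length ks                          ∎
  where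
  open ≡-Reasoning
  rest = filter (_∉ᶠ? ks) (allFin m)
  covers : ∀ i → i ∈ ks ++ rest
  covers i with i ∈ᶠ? ks
  ... | yes i∈ks = ∈ₚ.∈-++⁺ˡ i∈ks
  ... | no  i∉ks = ∈ₚ.∈-++⁺ʳ ks (∈ₚ.∈-filter⁺ (_∉ᶠ? ks) (∈ₚ.∈-allFin i) i∉ks)
  bag = unique∧set⇒bag
    (Uniqueₚ.++⁺ uniq (Uniqueₚ.filter⁺ (_∉ᶠ? ks) (Uniqueₚ.allFin⁺ m))
      λ (i∈ks , i∈rest) → proj₂ (∈ₚ.∈-filter⁻ (_∉ᶠ? ks) {xs = allFin m} i∈rest) i∈ks)
    (Uniqueₚ.allFin⁺ m)
    (mk⇔ (λ _ → ∈ₚ.∈-allFin _) (λ _ → covers _))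

Balanced⇒quiddity : (c : Vector ℤ (suc n)) (ks : List (Fin (suc n))) → Unique ks →
  Balanced -1ℤ (masked c ks) → IsQuiddityCycleOfLength (suc n ∸ length ks) (c omit ks)
Balanced⇒quiddity c ks uniq bal = length-omit c uniq , trans (η∏-omit c ks) (∏≡scalar bal)

-- Negating all entries.

-- η (- c) = - (D · η c · D) for D = diag (1, -1); twist (parity r) is (-1)^r times
-- conjugation by D.
twist : Parity → Mat₂ → Mat₂
twist 0ℙ (mat a b c d) = mat a (- b) (- c) d
twist 1ℙ (mat a b c d) = mat (- a) b c (- d)

η-twist : ∀ x p M → η (- x) · twist p M ≡ twist (p ⁻¹) (η x · M)
η-twist x 0ℙ (mat a b c d) = mat-cong (e₁ x a c) (e₂ x b d) (e₃ a c) (e₄ b d)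
  where
  e₁ : ∀ x a c → - x * a + -1ℤ * - c ≡ - (x * a + -1ℤ * c)
  e₁ = solve-∀
  e₂ : ∀ x b d → - x * - b + -1ℤ * d ≡ x * b + -1ℤ * d
  e₂ = solve-∀
  e₃ : ∀ a c → 1ℤ * a + 0ℤ * - c ≡ 1ℤ * a + 0ℤ * c
  e₃ = solve-∀
  e₄ : ∀ b d → 1ℤ * - b + 0ℤ * d ≡ - (1ℤ * b + 0ℤ * d)
  e₄ = solve-∀
η-twist x 1ℙ (mat a b c d) = mat-cong (e₁ x a c) (e₂ x b d) (e₃ a c) (e₄ b d)
  where
  e₁ : ∀ x a c → - x * - a + -1ℤ * c ≡ x * a + -1ℤ * c
  e₁ = solve-∀
  e₂ : ∀ x b d → - x * b + -1ℤ * - d ≡ - (x * b + -1ℤ * d)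
  e₂ = solve-∀
  e₃ : ∀ a c → 1ℤ * - a + 0ℤ * c ≡ - (1ℤ * a + 0ℤ * c)
  e₃ = solve-∀
  e₄ : ∀ b d → 1ℤ * b + 0ℤ * - d ≡ 1ℤ * b + 0ℤ * d
  e₄ = solve-∀

η∏-neg : ∀ cs → η∏ (map -_ cs) ≡ twist (parity (length cs)) (η∏ cs)
η∏-neg []       = refl
η∏-neg (c ∷ cs) = begin
  η (- c) · η∏ (map -_ cs)
    ≡⟨ cong (η (- c) ·_) (η∏-neg cs) ⟩
  η (- c) · twist (parity (length cs)) (η∏ cs)
    ≡⟨ η-twist c (parity (length cs)) (η∏ cs) ⟩
  twist (parity (length cs) ⁻¹) (η c · η∏ cs)
    ≡⟨ cong (λ p → twist p (η c · η∏ cs)) (⁻¹-selfInverse (suc-homo-⁻¹ (length cs))) ⟩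
  twist (parity (suc (length cs))) (η c · η∏ cs) ∎
  where open ≡-Reasoning

-- Conjugation by D fixes the identity matrix, so an odd number of negated letters turns the product
-- `I` into `-I`.
Balanced⇒negated-quiddity : (c : Vector ℤ (suc n)) (ks : List (Fin (suc n))) → Unique ks →
  parity (suc n ∸ length ks) ≡ 1ℙ → Balanced 1ℤ (masked c ks) →
  IsQuiddityCycleOfLength (suc n ∸ length ks) (map -_ (c omit ks))
Balanced⇒negated-quiddity c ks uniq odd bal =
  trans (Listₚ.length-map -_ (c omit ks)) (length-omit c uniq) ,
  (begin
    η∏ (map -_ (c omit ks))                              ≡⟨ η∏-neg (c omit ks) ⟩
    twist (parity (length (c omit ks))) (η∏ (c omit ks)) ≡⟨ cong₂ twist odd′ (trans (η∏-omit c ks) (∏≡scalar bal)) ⟩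
    twist 1ℙ I                                           ≡⟨⟩
    -I                                                   ∎)
  where
  open ≡-Reasoning
  odd′ = trans (cong parity (length-omit c uniq)) odd

-- Contractions at a single entry 1, 0 or -1.

+=-at : ∀ {m} (c : Vector ℤ m) i x → (c [ i ]+= x) i ≡ c i + x
+=-at c i x = updateAt-updates i c

+=-off : ∀ {m} (c : Vector ℤ m) {i j} x → j ≢ i → (c [ i ]+= x) j ≡ c j
+=-off c {i} {j} x j≢i = updateAt-minimal j i c j≢i

neighbours : (k : Fin (suc n)) → ∃[ t ] (prev k ≡ pos t × k ≡ pos (1 ℕ.+ t) × next k ≡ pos (2 ℕ.+ t))
neighbours {n} k = toℕ k ℕ.+ n , refl , sym (pos-centre k) , sym (pos-next k)

pos-≢′ : ∀ {i j : Fin (suc n)} {x y} b → i ≡ pos (x ℕ.+ b) → j ≡ pos (y ℕ.+ b) → x < y → y < suc n → i ≢ j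
pos-≢′ b i≡ j≡ x<y y<m i≡j = pos-≢ b x<y y<m (trans (sym i≡) (trans i≡j j≡))

prev≢self : 2 ≤ n → (k : Fin (suc n)) → prev k ≢ k
prev≢self 2≤n k = let t , p , c , _ = neighbours k in
  pos-≢′ t p c z<s (s≤s (ℕₚ.<⇒≤ 2≤n))

next≢self : 2 ≤ n → (k : Fin (suc n)) → k ≢ next k
next≢self 2≤n k = let t , _ , c , q = neighbours k in
  pos-≢′ t c q (s<s z<s) (s≤s 2≤n)

prev≢next : 2 ≤ n → (k : Fin (suc n)) → prev k ≢ next k
prev≢next 2≤n k = let t , p , _ , q = neighbours k in
  pos-≢′ t p q z<s (s≤s 2≤n)

scalar-mat : ∀ s a b c d → scalar s · mat a b c d ≡ mat (s * a) (s * b) (s * c) (s * d)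
scalar-mat s a b c d = mat-cong (top s a c) (top s b d) (bottom s a c) (bottom s b d)
  where
  top : ∀ s x y → s * x + 0ℤ * y ≡ s * x
  top = solve-∀
  bottom : ∀ s x y → 0ℤ * x + s * y ≡ s * y
  bottom = solve-∀

η·η : ∀ a b → η a · η b ≡ mat (a * b + -1ℤ) (- a) b -1ℤ
η·η a b = mat-cong refl (e₂ a) (e₃ b) refl
  where
  e₂ : ∀ a → a * -1ℤ + -1ℤ * 0ℤ ≡ - a
  e₂ = solve-∀
  e₃ : ∀ b → 1ℤ * b + 0ℤ * 1ℤ ≡ b
  e₃ = solve-∀

η·η·η : ∀ a e b → η a · (η e · η b) ≡ mat (a * e * b + - a + - b) (1ℤ + - (a * e)) (e * b + -1ℤ) (- e)
η·η·η a e b = trans (cong (η a ·_) (η·η e b))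
  (mat-cong (e₁ a e b) (e₂ a e) (e₃ e b) (e₄ e))
  where
  e₁ : ∀ a e b → a * (e * b + -1ℤ) + -1ℤ * b ≡ a * e * b + - a + - b
  e₁ = solve-∀
  e₂ : ∀ a e → a * - e + -1ℤ * -1ℤ ≡ 1ℤ + - (a * e)
  e₂ = solve-∀
  e₃ : ∀ e b → 1ℤ * (e * b + -1ℤ) + 0ℤ * b ≡ e * b + -1ℤ
  e₃ = solve-∀
  e₄ : ∀ e → 1ℤ * - e + 0ℤ * -1ℤ ≡ - e
  e₄ = solve-∀

scalar-η·η·η : ∀ s a e b → scalar s · (η a · (η e · η b)) ≡
  mat (s * (a * e * b + - a + - b)) (s * (1ℤ + - (a * e))) (s * (e * b + -1ℤ)) (s * - e)
scalar-η·η·η s a e b = trans (cong (scalar s ·_) (η·η·η a e b)) (scalar-mat s _ _ _ _)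

-- The entries agree modulo ε² = 1 and not as polynomials in ε, so both units are substituted before
-- the ring solver is called. The factor `I` stands for the omitted middle letter.
unit-window : ∀ {ε} → ε ≡ 1ℤ ⊎ ε ≡ -1ℤ → ∀ a b →
  η (a + - ε) · (I · η (b + - ε)) ≡ scalar ε · (η a · (η ε · η b))
unit-window {ε} unit a b = begin
  η (a + - ε) · (I · η (b + - ε))
    ≡⟨ cong (η (a + - ε) ·_) (·-identityˡ (η (b + - ε))) ⟩
  η (a + - ε) · η (b + - ε)
    ≡⟨ η·η (a + - ε) (b + - ε) ⟩
  mat ((a + - ε) * (b + - ε) + -1ℤ) (- (a + - ε)) (b + - ε) -1ℤ
    ≡⟨ entries unit ⟩
  mat (ε * (a * ε * b + - a + - b)) (ε * (1ℤ + - (a * ε))) (ε * (ε * b + -1ℤ)) (ε * - ε)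
    ≡⟨ scalar-η·η·η ε a ε b ⟨
  scalar ε · (η a · (η ε · η b)) ∎
  where
  open ≡-Reasoning
  entries : ε ≡ 1ℤ ⊎ ε ≡ -1ℤ →
    mat ((a + - ε) * (b + - ε) + -1ℤ) (- (a + - ε)) (b + - ε) -1ℤ ≡
    mat (ε * (a * ε * b + - a + - b)) (ε * (1ℤ + - (a * ε))) (ε * (ε * b + -1ℤ)) (ε * - ε)
  entries (inj₁ refl) = mat-cong (e₁ a b) (e₂ a) (e₃ b) refl
    where
    e₁ : ∀ a b → (a + -1ℤ) * (b + -1ℤ) + -1ℤ ≡ 1ℤ * (a * 1ℤ * b + - a + - b)
    e₁ = solve-∀
    e₂ : ∀ a → - (a + -1ℤ) ≡ 1ℤ * (1ℤ + - (a * 1ℤ))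
    e₂ = solve-∀
    e₃ : ∀ b → b + -1ℤ ≡ 1ℤ * (1ℤ * b + -1ℤ)
    e₃ = solve-∀
  entries (inj₂ refl) = mat-cong (e₁ a b) (e₂ a) (e₃ b) refl
    where
    e₁ : ∀ a b → (a + 1ℤ) * (b + 1ℤ) + -1ℤ ≡ -1ℤ * (a * -1ℤ * b + - a + - b)
    e₁ = solve-∀
    e₂ : ∀ a → - (a + 1ℤ) ≡ -1ℤ * (1ℤ + - (a * -1ℤ))
    e₂ = solve-∀
    e₃ : ∀ b → b + 1ℤ ≡ -1ℤ * (-1ℤ * b + -1ℤ)
    e₃ = solve-∀

zero-window : ∀ a b → η (a + b) · (I · I) ≡ scalar -1ℤ · (η a · (η 0ℤ · η b))
zero-window a b = begin
  η (a + b) · (I · I) ≡⟨ ·-identityʳ (η (a + b)) ⟩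
  η (a + b)           ≡⟨ mat-cong (e₁ a b) (e₂ a) (e₃ b) refl ⟩
  mat (-1ℤ * (a * 0ℤ * b + - a + - b)) (-1ℤ * (1ℤ + - (a * 0ℤ))) (-1ℤ * (0ℤ * b + -1ℤ)) (-1ℤ * - 0ℤ)
                      ≡⟨ scalar-η·η·η -1ℤ a 0ℤ b ⟨
  scalar -1ℤ · (η a · (η 0ℤ · η b)) ∎
  where
  open ≡-Reasoning
  e₁ : ∀ a b → a + b ≡ -1ℤ * (a * 0ℤ * b + - a + - b)
  e₁ = solve-∀
  e₂ : ∀ a → -1ℤ ≡ -1ℤ * (1ℤ + - (a * 0ℤ))
  e₂ = solve-∀
  e₃ : ∀ b → 1ℤ ≡ -1ℤ * (0ℤ * b + -1ℤ)
  e₃ = solve-∀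

∉-∷ : ∀ {A : Set} {x y : A} {xs} → x ≢ y → x ∉ xs → x ∉ y ∷ xs
∉-∷ x≢y x∉xs (here x≡y)   = x≢y x≡y
∉-∷ x≢y x∉xs (there x∈xs) = x∉xs x∈xs

∈-drop : ∀ {A : Set} {x y : A} {xs} → x ≢ y → x ∈ y ∷ xs → x ∈ xs
∈-drop x≢y (here x≡y)   = contradiction x≡y x≢y
∈-drop x≢y (there x∈xs) = x∈xs

-- The positions `ks` omitted earlier are a parameter so that two contractions can be composed; the
-- window around k has to avoid them.
reduce-unit : ∀ (c : Vector ℤ (suc n)) ks {ε} k → 2 ≤ n → ε ≡ 1ℤ ⊎ ε ≡ -1ℤ → c k ≡ ε →
  prev k ∉ ks → k ∉ ks → next k ∉ ks → Balanced s (masked c ks) →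
  Balanced (ε * s) (masked (c [ prev k ]+= - ε [ next k ]+= - ε) (k ∷ ks))
reduce-unit {n} {s} c ks {ε} k 2≤n unit ck≡ε p∉ k∉ q∉ =
  replace-window {u = masked c ks} {v = masked c′ (k ∷ ks)} {σ = ε} k 2≤n agree window
  where
  c₁ = c [ prev k ]+= - ε
  c′ = c₁ [ next k ]+= - ε
  agree : ∀ i → i ≢ prev k → i ≢ k → i ≢ next k → masked c′ (k ∷ ks) i ≡ masked c ks i
  agree i i≢p i≢k i≢q = masked-cong c′ c {k ∷ ks} {ks} (∈-drop i≢k) there
    λ _ → trans (+=-off c₁ (- ε) i≢q) (+=-off c (- ε) i≢p)
  window : factor (masked c′ (k ∷ ks) (prev k)) ·
             (factor (masked c′ (k ∷ ks) k) · factor (masked c′ (k ∷ ks) (next k)))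
           ≡ scalar ε · (factor (masked c ks (prev k)) ·
             (factor (masked c ks k) · factor (masked c ks (next k))))
  window
    rewrite masked-∉ c p∉ | masked-∉ c k∉ | masked-∉ c q∉
          | masked-∉ c′ {k ∷ ks} (∉-∷ (prev≢self 2≤n k) p∉)
          | masked-∈ c′ {k ∷ ks} {k} (here refl)
          | masked-∉ c′ {k ∷ ks} (∉-∷ (next≢self 2≤n k ∘ sym) q∉)
          | +=-off c₁ (- ε) (prev≢next 2≤n k) | +=-at c (prev k) (- ε)
          | +=-at c₁ (next k) (- ε) | +=-off c (- ε) (prev≢next 2≤n k ∘ sym)
          | ck≡ε
    = unit-window unit (c (prev k)) (c (next k))

reduce-zero : ∀ (c : Vector ℤ (suc n)) ks k → 2 ≤ n → c k ≡ 0ℤ →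
  prev k ∉ ks → k ∉ ks → next k ∉ ks → Balanced s (masked c ks) →
  Balanced (-1ℤ * s) (masked (c [ prev k ]+= c (next k)) (k ∷ next k ∷ ks))
reduce-zero {n} {s} c ks k 2≤n ck≡0 p∉ k∉ q∉ =
  replace-window {u = masked c ks} {v = masked c′ ks′} {σ = -1ℤ} k 2≤n agree window
  where
  c′ = c [ prev k ]+= c (next k)
  ks′ = k ∷ next k ∷ ks
  agree : ∀ i → i ≢ prev k → i ≢ k → i ≢ next k → masked c′ ks′ i ≡ masked c ks i
  agree i i≢p i≢k i≢q = masked-cong c′ c {ks′} {ks} (∈-drop i≢q ∘ ∈-drop i≢k) (there ∘ there)
    λ _ → +=-off c (c (next k)) i≢p
  window : factor (masked c′ ks′ (prev k)) · (factor (masked c′ ks′ k) · factor (masked c′ ks′ (next k)))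
           ≡ scalar -1ℤ · (factor (masked c ks (prev k)) ·
             (factor (masked c ks k) · factor (masked c ks (next k))))
  window
    rewrite masked-∉ c p∉ | masked-∉ c k∉ | masked-∉ c q∉
          | masked-∉ c′ {ks′} (∉-∷ (prev≢self 2≤n k) (∉-∷ (prev≢next 2≤n k) p∉))
          | masked-∈ c′ {ks′} {k} (here refl)
          | masked-∈ c′ {ks′} {next k} (there (here refl))
          | +=-at c (prev k) (c (next k))
          | ck≡0
    = zero-window (c (prev k)) (c (next k))

-- Growth of the first column and existence of small entries.

-- The triangle inequality gives 2|x| ≤ |cx| ≤ |cx - y| + |y| < |cx - y| + |x|, and one |x| cancels.
∣x∣<∣cx-y∣ : ∀ c x y → 2 ≤ ∣ c ∣ → ∣ y ∣ < ∣ x ∣ → ∣ x ∣ < ∣ c * x + -1ℤ * y ∣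
∣x∣<∣cx-y∣ c x y 2≤∣c∣ ∣y∣<∣x∣ = ℕₚ.+-cancelʳ-< (∣ x ∣) _ _ (begin-strict
  ∣ x ∣ ℕ.+ ∣ x ∣                     ≡⟨ cong (∣ x ∣ ℕ.+_) (ℕₚ.+-identityʳ (∣ x ∣)) ⟨
  2 ℕ.* ∣ x ∣                         ≤⟨ ℕₚ.*-monoˡ-≤ (∣ x ∣) 2≤∣c∣ ⟩
  ∣ c ∣ ℕ.* ∣ x ∣                     ≡⟨ ℤₚ.abs-* c x ⟨
  ∣ c * x ∣                           ≡⟨ cong ∣_∣ (split c x y) ⟩
  ∣ c * x + -1ℤ * y + y ∣             ≤⟨ ℤₚ.∣i+j∣≤∣i∣+∣j∣ (c * x + -1ℤ * y) y ⟩
  ∣ c * x + -1ℤ * y ∣ ℕ.+ ∣ y ∣       <⟨ ℕₚ.+-monoʳ-< (∣ c * x + -1ℤ * y ∣) ∣y∣<∣x∣ ⟩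
  ∣ c * x + -1ℤ * y ∣ ℕ.+ ∣ x ∣       ∎)
  where
  open ℕₚ.≤-Reasoning
  split : ∀ c x y → c * x ≡ c * x + -1ℤ * y + y
  split = solve-∀

e₂₁-η· : ∀ c M → e₂₁ (η c · M) ≡ e₁₁ M
e₂₁-η· c (mat x y z w) = bottom x z
  where
  bottom : ∀ x z → 1ℤ * x + 0ℤ * z ≡ x
  bottom = solve-∀

-- Multiplying by `η c` on the left takes the first column (x , y) to (cx - y , x). Starting from (1
-- , 0), the inequality |x| > |y| persists as long as no small letter is met; the disjunction makes
-- the small letter explicit.
column-growth : ∀ (c : ℕ → ℤ) a r →
  (∃[ d ] (d < r × ∣ c (d ℕ.+ a) ∣ < 2)) ⊎ ∣ e₂₁ (∏ (just ∘ c) a r) ∣ < ∣ e₁₁ (∏ (just ∘ c) a r) ∣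
column-growth c a zero = inj₂ z<s
column-growth c a (suc r) with ∣ c a ∣ ℕ.<? 2 | column-growth c (suc a) r
... | yes small | _ = inj₁ (0 , z<s , small)
... | no _ | inj₁ (d , d<r , small) =
  inj₁ (suc d , s<s d<r , subst (λ t → ∣ c t ∣ < 2) (ℕₚ.+-suc d a) small)
... | no large | inj₂ grows = inj₂ (subst (_< ∣ e₁₁ (η (c a) · M) ∣)
  (cong ∣_∣ (sym (e₂₁-η· (c a) M)))
  (∣x∣<∣cx-y∣ (c a) (e₁₁ M) (e₂₁ M) (ℕₚ.≮⇒≥ large) grows))
  where M = ∏ (just ∘ c) (suc a) r

-- If no letter is small, growth applies twice: without the first letter the upper entry x satisfies
-- |x| ≥ 1, and x is the lower entry once that letter is multiplied in, so the new upper entry has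
-- absolute value at least 2.
small-entry : ∀ (c : ℕ → ℤ) a r → ∣ e₁₁ (∏ (just ∘ c) a (suc r)) ∣ < 2 →
              ∃[ d ] (d < suc r × ∣ c (d ℕ.+ a) ∣ < 2)
small-entry c a r bounded with column-growth c (suc a) r | column-growth c a (suc r)
... | inj₁ (d , d<r , small) | _ =
  suc d , s<s d<r , subst (λ t → ∣ c t ∣ < 2) (ℕₚ.+-suc d a) small
... | inj₂ _ | inj₁ found = found
... | inj₂ inner | inj₂ outer = contradiction bounded (ℕₚ.≤⇒≯ (ℕₚ.≤-trans (s≤s 1≤e₂₁) outer))
  where
  1≤e₂₁ : 1 ≤ ∣ e₂₁ (∏ (just ∘ c) a (suc r)) ∣
  1≤e₂₁ = subst (1 ≤_) (cong ∣_∣ (sym (e₂₁-η· (c a) (∏ (just ∘ c) (suc a) r)))) (ℕₚ.≤-trans (s≤s z≤n) inner)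

-- The first column of η(c)⁻¹ · -I · η(c′)⁻¹ is (1 , c).
η·M·η≡-I : ∀ c M c′ → η c · (M · η c′) ≡ -I → e₁₁ M ≡ 1ℤ × e₂₁ M ≡ c
η·M·η≡-I c (mat x y z w) c′ eq = x≡1 , z≡c
  where
  open ≡-Reasoning
  x≡1 : x ≡ 1ℤ
  x≡1 = begin
    x                                              ≡⟨ e x y z w ⟩
    - (1ℤ * (x * -1ℤ + y * 0ℤ) + 0ℤ * (z * -1ℤ + w * 0ℤ)) ≡⟨ cong (-_ ∘ e₂₂) eq ⟩
    1ℤ                                             ∎
    where
    e : ∀ x y z w → x ≡ - (1ℤ * (x * -1ℤ + y * 0ℤ) + 0ℤ * (z * -1ℤ + w * 0ℤ))
    e = solve-∀
  z≡c : z ≡ c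
  z≡c = begin
    z                                                          ≡⟨ e c x y z w ⟩
    c * (x * -1ℤ + y * 0ℤ) + -1ℤ * (z * -1ℤ + w * 0ℤ) + c * x  ≡⟨ cong₂ (λ p q → p + c * q) (cong e₁₂ eq) x≡1 ⟩
    0ℤ + c * 1ℤ                                                ≡⟨ trans (ℤₚ.+-identityˡ (c * 1ℤ)) (ℤₚ.*-identityʳ c) ⟩
    c                                                          ∎
    where
    e : ∀ c x y z w → z ≡ c * (x * -1ℤ + y * 0ℤ) + -1ℤ * (z * -1ℤ + w * 0ℤ) + c * x
    e = solve-∀

middle-column : ∀ (c : ℕ → ℤ) a r → ∏ (just ∘ c) a (2 ℕ.+ r) ≡ -I →
  e₁₁ (∏ (just ∘ c) (suc a) r) ≡ 1ℤ × e₂₁ (∏ (just ∘ c) (suc a) r) ≡ c a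
middle-column c a r eq = η·M·η≡-I (c a) (∏ (just ∘ c) (suc a) r) (c (r ℕ.+ suc a))
  (trans (cong (η (c a) ·_) (sym (∏-snoc (just ∘ c) (suc a) r))) eq)

-- Contractions of a whole quiddity cycle, at one entry and at two.

+=-cong : ∀ {m} {c c′ : Vector ℤ m} i x → c ≗ c′ → (c [ i ]+= x) ≗ (c′ [ i ]+= x)
+=-cong {c = c} {c′} i x c≗c′ j with j Finₚ.≟ i
... | yes refl = trans (+=-at c i x) (trans (cong (_+ x) (c≗c′ i)) (sym (+=-at c′ i x)))
... | no  j≢i  = trans (+=-off c x j≢i) (trans (c≗c′ j) (sym (+=-off c′ x j≢i)))

+=-twice : ∀ {m} (c : Vector ℤ m) i x y → (c [ i ]+= x [ i ]+= y) ≗ (c [ i ]+= (x + y))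
+=-twice c i x y = updateAt-updateAt-local i c (ℤₚ.+-assoc (c i) x y)

module _ {n} (2≤n : 2 ≤ n) (c : Vector ℤ (suc n)) (bal : Balanced -1ℤ (masked c [])) where

  single-one : ∀ k → c k ≡ 1ℤ →
    IsQuiddityCycleOfLength n (c [ prev k ]+= -1ℤ [ next k ]+= -1ℤ omit (k ∷ []))
  single-one k ck≡1 = Balanced⇒quiddity (c [ prev k ]+= -1ℤ [ next k ]+= -1ℤ) (k ∷ []) ([] ∷ [])
    (reduce-unit c [] k 2≤n (inj₁ refl) ck≡1 (λ ()) (λ ()) (λ ()) bal)

  single-minus-one : ∀ k → c k ≡ -1ℤ → parity n ≡ 1ℙ →
    IsQuiddityCycleOfLength n (map -_ (c [ prev k ]+= 1ℤ [ next k ]+= 1ℤ omit (k ∷ [])))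
  single-minus-one k ck≡-1 odd =
    Balanced⇒negated-quiddity (c [ prev k ]+= 1ℤ [ next k ]+= 1ℤ) (k ∷ []) ([] ∷ []) odd
    (reduce-unit c [] k 2≤n (inj₂ refl) ck≡-1 (λ ()) (λ ()) (λ ()) bal)

  single-zero : ∀ k → c k ≡ 0ℤ → parity (n ∸ 1) ≡ 1ℙ →
    IsQuiddityCycleOfLength (n ∸ 1) (map -_ (c [ prev k ]+= c (next k) omit (k ∷ next k ∷ [])))
  single-zero k ck≡0 odd =
    Balanced⇒negated-quiddity (c [ prev k ]+= c (next k)) (k ∷ next k ∷ [])
      ((next≢self 2≤n k ∷ []) ∷ [] ∷ []) odd
    (reduce-zero c [] k 2≤n ck≡0 (λ ()) (λ ()) (λ ()) bal)

  module _ (j k : Fin (suc n)) where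

    far-minus-ones :
      j ≢ k → next j ≢ k → prev j ≢ k → j ≢ next k → j ≢ prev k → c j ≡ -1ℤ → c k ≡ -1ℤ →
      Balanced -1ℤ (masked
        (c [ prev j ]+= 1ℤ [ next j ]+= 1ℤ [ prev k ]+= 1ℤ [ next k ]+= 1ℤ) (j ∷ k ∷ []))
    far-minus-ones j≢k qj≢k pj≢k j≢qk j≢pk cj≡-1 ck≡-1 = Balanced-cong
      {u = masked c₂ (k ∷ j ∷ [])} {masked c₂ (j ∷ k ∷ [])}
      (λ i → masked-cong c₂ c₂ {k ∷ j ∷ []} {j ∷ k ∷ []} {i} swap swap λ _ → refl)
      (reduce-unit c₁ (j ∷ []) k 2≤n (inj₂ refl)
        (trans (+=-off (c [ prev j ]+= 1ℤ) 1ℤ (qj≢k ∘ sym)) (trans (+=-off c 1ℤ (pj≢k ∘ sym)) ck≡-1))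
        (∉-∷ (j≢pk ∘ sym) λ ()) (∉-∷ (j≢k ∘ sym) λ ()) (∉-∷ (j≢qk ∘ sym) λ ())
        (reduce-unit c [] j 2≤n (inj₂ refl) cj≡-1 (λ ()) (λ ()) (λ ()) bal))
      where
      c₁ = c [ prev j ]+= 1ℤ [ next j ]+= 1ℤ
      c₂ = c₁ [ prev k ]+= 1ℤ [ next k ]+= 1ℤ
      swap : ∀ {i x y : Fin (suc n)} → i ∈ x ∷ y ∷ [] → i ∈ y ∷ x ∷ []
      swap (here i≡x)         = there (here i≡x)
      swap (there (here i≡y)) = here i≡y

    -- This is the previous construction with its two increments at the common neighbour merged into
    -- a single increment by 2.
    near-minus-ones : next j ≡ prev k →
      j ≢ k → next j ≢ k → prev j ≢ k → j ≢ next k → j ≢ prev k → c j ≡ -1ℤ → c k ≡ -1ℤ →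
      Balanced -1ℤ (masked (c [ prev j ]+= 1ℤ [ next j ]+= (+ 2) [ next k ]+= 1ℤ) (j ∷ k ∷ []))
    near-minus-ones qj≡pk j≢k qj≢k pj≢k j≢qk j≢pk cj≡-1 ck≡-1 = Balanced-cong
      {u = masked c₁ (j ∷ k ∷ [])} {masked c₂ (j ∷ k ∷ [])}
      (λ i → masked-cong c₁ c₂ {j ∷ k ∷ []} {j ∷ k ∷ []} {i} id id λ _ → c₁≗c₂ i)
      (far-minus-ones j≢k qj≢k pj≢k j≢qk j≢pk cj≡-1 ck≡-1)
      where
      c₁ = c [ prev j ]+= 1ℤ [ next j ]+= 1ℤ [ prev k ]+= 1ℤ [ next k ]+= 1ℤ
      c₂ = c [ prev j ]+= 1ℤ [ next j ]+= (+ 2) [ next k ]+= 1ℤ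
      c₁≗c₂ : c₁ ≗ c₂
      c₁≗c₂ = +=-cong (next k) 1ℤ
        (subst (λ i → (c [ prev j ]+= 1ℤ [ next j ]+= 1ℤ [ i ]+= 1ℤ) ≗ (c [ prev j ]+= 1ℤ [ next j ]+= (+ 2)))
          qj≡pk (+=-twice (c [ prev j ]+= 1ℤ) (next j) 1ℤ 1ℤ))

    private
      ∈-swap₂ : ∀ {i w x y z : Fin (suc n)} → i ∈ w ∷ x ∷ y ∷ z ∷ [] → i ∈ y ∷ z ∷ w ∷ x ∷ []
      ∈-swap₂ (here eq)                         = there (there (here eq))
      ∈-swap₂ (there (here eq))                 = there (there (there (here eq)))
      ∈-swap₂ (there (there (here eq)))         = here eq
      ∈-swap₂ (there (there (there (here eq)))) = there (here eq)

    -- A contraction at a zero also omits the next position, so `next j` too must stay outside the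
    -- window of k. As prev j differs from next k, the amount added in the second contraction is
    -- still the original entry.
    far-zeros :
      j ≢ k → j ≢ next k → j ≢ prev k → next j ≢ k → next j ≢ next k → next j ≢ prev k →
      prev j ≢ k → prev j ≢ next k → c j ≡ 0ℤ → c k ≡ 0ℤ →
      Balanced -1ℤ (masked (c [ prev j ]+= c (next j) [ prev k ]+= c (next k)) (j ∷ next j ∷ k ∷ next k ∷ []))
    far-zeros j≢k j≢qk j≢pk qj≢k qj≢qk qj≢pk pj≢k pj≢qk cj≡0 ck≡0 = Balanced-cong
      {u = masked c₂ (k ∷ next k ∷ j ∷ next j ∷ [])} {masked c₃ (j ∷ next j ∷ k ∷ next k ∷ [])}
      (λ i → masked-cong c₂ c₃ {k ∷ next k ∷ j ∷ next j ∷ []} {j ∷ next j ∷ k ∷ next k ∷ []} {i}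
        ∈-swap₂ ∈-swap₂
        λ _ → cong (λ x → (c₁ [ prev k ]+= x) i) (+=-off c (c (next j)) (pj≢qk ∘ sym)))
      (reduce-zero c₁ (j ∷ next j ∷ []) k 2≤n (trans (+=-off c (c (next j)) (pj≢k ∘ sym)) ck≡0)
        (∉-∷ (j≢pk ∘ sym) (∉-∷ (qj≢pk ∘ sym) λ ()))
        (∉-∷ (j≢k ∘ sym) (∉-∷ (qj≢k ∘ sym) λ ()))
        (∉-∷ (j≢qk ∘ sym) (∉-∷ (qj≢qk ∘ sym) λ ()))
        (reduce-zero c [] j 2≤n cj≡0 (λ ()) (λ ()) (λ ()) bal))
      where
      c₁ = c [ prev j ]+= c (next j)
      c₂ = c₁ [ prev k ]+= c₁ (next k)
      c₃ = c₁ [ prev k ]+= c (next k)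

    -- Contracting at k first leaves the sum c_{j+1} + c_{k+1} at position j + 1 = k - 1,
    -- from where the contraction at j moves it to position j - 1.
    near-zeros : next j ≡ prev k →
      j ≢ k → j ≢ next k → j ≢ prev k → next j ≢ k → next j ≢ next k →
      prev j ≢ k → prev j ≢ next k → c j ≡ 0ℤ → c k ≡ 0ℤ →
      Balanced -1ℤ (masked (c [ prev j ]+= (c (next j) + c (next k))) (j ∷ next j ∷ k ∷ next k ∷ []))
    near-zeros qj≡pk j≢k j≢qk j≢pk qj≢k qj≢qk pj≢k pj≢qk cj≡0 ck≡0 = Balanced-cong
      {u = masked c₂ ks} {masked c₃ ks}
      (λ i → masked-cong c₂ c₃ {ks} {ks} {i} id id (c₂≡c₃ i))
      (reduce-zero c₁ (k ∷ next k ∷ []) j 2≤n (trans (+=-off c (c (next k)) j≢pk) cj≡0)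
        (∉-∷ pj≢k (∉-∷ pj≢qk λ ())) (∉-∷ j≢k (∉-∷ j≢qk λ ())) (∉-∷ qj≢k (∉-∷ qj≢qk λ ()))
        (reduce-zero c [] k 2≤n ck≡0 (λ ()) (λ ()) (λ ()) bal))
      where
      ks = j ∷ next j ∷ k ∷ next k ∷ []
      c₁ = c [ prev k ]+= c (next k)
      c₂ = c₁ [ prev j ]+= c₁ (next j)
      x = c (next j) + c (next k)
      c₃ = c [ prev j ]+= x
      c₁qj≡x : c₁ (next j) ≡ x
      c₁qj≡x = subst (λ i → c₁ i ≡ c i + c (next k)) (sym qj≡pk) (+=-at c (prev k) (c (next k)))
      -- The contraction at k altered only the entry at `prev k`, which is `next j` and hence
      -- omitted.
      c₂≡c₃ : ∀ i → i ∉ ks → c₂ i ≡ c₃ i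
      c₂≡c₃ i i∉ks with i Finₚ.≟ prev j
      ... | yes refl = trans (+=-at c₁ i (c₁ (next j))) (trans (cong₂ _+_
        (+=-off c (c (next k)) (λ i≡pk → i∉ks (there (here (trans i≡pk (sym qj≡pk)))))) c₁qj≡x)
        (sym (+=-at c i x)))
      ... | no i≢pj = trans (+=-off c₁ (c₁ (next j)) i≢pj) (trans
        (+=-off c (c (next k)) (λ i≡pk → i∉ks (there (here (trans i≡pk (sym qj≡pk))))))
        (sym (+=-off c x i≢pj)))

-- Pairs of small entries that are not adjacent.

small⇒-1,0,1 : ∀ x → ∣ x ∣ < 2 → x ≡ 1ℤ ⊎ x ≡ 0ℤ ⊎ x ≡ -1ℤ
small⇒-1,0,1 (+ 0)          _ = inj₂ (inj₁ refl)
small⇒-1,0,1 (+ 1)          _ = inj₁ refl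
small⇒-1,0,1 (+ suc (suc _)) (s≤s (s≤s ()))
small⇒-1,0,1 -[1+ 0 ]       _ = inj₂ (inj₂ refl)
small⇒-1,0,1 -[1+ suc _ ]   (s≤s (s≤s ()))

SingleOne SingleZero SingleMinusOne : ∀ {m} → Vector ℤ m → Set
SingleOne {m} c =
  ∃[ k ] (c k ≡ 1ℤ ×
    IsQuiddityCycleOfLength (m ∸ 1)
      (c [ prev k ]+= -1ℤ [ next k ]+= -1ℤ omit (k ∷ [])))
SingleZero {m} c =
  ∃[ k ] (c k ≡ 0ℤ ×
    IsQuiddityCycleOfLength (m ∸ 2)
      (map -_ (c [ prev k ]+= c (next k) omit (k ∷ next k ∷ []))))
SingleMinusOne {m} c =
  ∃[ k ] (c k ≡ -1ℤ ×
    IsQuiddityCycleOfLength (m ∸ 1)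
      (map -_ (c [ prev k ]+= 1ℤ [ next k ]+= 1ℤ omit (k ∷ []))))

DoubleZero DoubleMinusOne : ∀ {m} → Vector ℤ m → Set
DoubleZero {m} c =
  ∃[ j ] ∃[ k ] (NotCyclicallyAdjacent j k × c j ≡ 0ℤ × c k ≡ 0ℤ ×
    ( (2 < cyclicDistance j k ×
        IsQuiddityCycleOfLength (m ∸ 4)
          (c [ prev j ]+= c (next j) [ prev k ]+= c (next k)
            omit (j ∷ next j ∷ k ∷ next k ∷ [])))
    ⊎ (next j ≡ prev k ×
        IsQuiddityCycleOfLength (m ∸ 4)
          (c [ prev j ]+= (c (next j) + c (next k))
            omit (j ∷ next j ∷ k ∷ next k ∷ [])))))
DoubleMinusOne {m} c =
  ∃[ j ] ∃[ k ] (NotCyclicallyAdjacent j k × c j ≡ -1ℤ × c k ≡ -1ℤ ×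
    ( (2 < cyclicDistance j k ×
        IsQuiddityCycleOfLength (m ∸ 2)
          (c [ prev j ]+= 1ℤ [ next j ]+= 1ℤ [ prev k ]+= 1ℤ [ next k ]+= 1ℤ
            omit (j ∷ k ∷ [])))
    ⊎ (next j ≡ prev k ×
        IsQuiddityCycleOfLength (m ∸ 2)
          (c [ prev j ]+= 1ℤ [ next j ]+= (+ 2) [ next k ]+= 1ℤ
            omit (j ∷ k ∷ [])))))

module _ {n} (c : Vector ℤ (4 ℕ.+ n)) (bal : Balanced -1ℤ (masked c [])) where

  private
    C : ℕ → ℤ
    C t = c (pos t)

    2≤m-1 : 2 ≤ 3 ℕ.+ n
    2≤m-1 = s≤s (s≤s z≤n)

    ∏-cyclic : ∀ a → ∏ (just ∘ C) a (4 ℕ.+ n) ≡ -I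
    ∏-cyclic a = rotate (masked c []) a (∏≡scalar bal)

  -- Positions are measured from b, the one before j: prev j, j, next j, prev k, k, next k have
  -- offsets 0, 1, 2, 2 + d, 3 + d, 4 + d. The bound on d keeps all of them below the length, so
  -- that only next j and prev k can coincide, namely for d = 0.
  module Pair (b d : ℕ) (d<n : d < n) where

    j k : Fin (4 ℕ.+ n)
    j = pos (1 ℕ.+ b)
    k = pos (3 ℕ.+ d ℕ.+ b)

    pj : prev j ≡ pos b
    pj = prev-pos b
    qj : next j ≡ pos (2 ℕ.+ b)
    qj = next-pos (1 ℕ.+ b)
    pk : prev k ≡ pos (2 ℕ.+ d ℕ.+ b)
    pk = prev-pos (2 ℕ.+ d ℕ.+ b)
    qk : next k ≡ pos (4 ℕ.+ d ℕ.+ b)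
    qk = next-pos (3 ℕ.+ d ℕ.+ b)

    4+d<m : 4 ℕ.+ d < 4 ℕ.+ n
    4+d<m = ℕₚ.+-monoʳ-< 4 d<n
    3+d<m : 3 ℕ.+ d < 4 ℕ.+ n
    3+d<m = ℕₚ.<⇒≤ 4+d<m
    2+d<m : 2 ℕ.+ d < 4 ℕ.+ n
    2+d<m = ℕₚ.<⇒≤ 3+d<m

    j≢k : j ≢ k
    j≢k = pos-≢′ b refl refl (ℕₚ.m≤m+n 2 (1 ℕ.+ d)) 3+d<m
    j≢qk : j ≢ next k
    j≢qk = pos-≢′ b refl qk (ℕₚ.m≤m+n 2 (2 ℕ.+ d)) 4+d<m
    j≢pk : j ≢ prev k
    j≢pk = pos-≢′ b refl pk (ℕₚ.m≤m+n 2 d) 2+d<m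
    qj≢k : next j ≢ k
    qj≢k = pos-≢′ b qj refl (ℕₚ.m≤m+n 3 d) 3+d<m
    qj≢qk : next j ≢ next k
    qj≢qk = pos-≢′ b qj qk (ℕₚ.m≤m+n 3 (1 ℕ.+ d)) 4+d<m
    pj≢k : prev j ≢ k
    pj≢k = pos-≢′ b pj refl z<s 3+d<m
    pj≢qk : prev j ≢ next k
    pj≢qk = pos-≢′ b pj qk z<s 4+d<m

    -- One way round, j and k are 2 + d apart; the other way they are 2 + n - d apart, which is at
    -- least 3.
    distance> : ∀ {e} → e < 2 ℕ.+ d → e ≤ 2 → e < cyclicDistance j k
    distance> {e} e<2+d e≤2 = subst (λ t → e < cyclicDistance j (pos t)) (ℕₚ.+-suc (2 ℕ.+ d) b)
      (cyclicDistance-> (2 ℕ.+ d) (1 ℕ.+ b) e<2+d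
        (ℕₚ.≤-<-trans (ℕₚ.+-monoˡ-≤ (2 ℕ.+ d) e≤2) 4+d<m))

    nonAdjacent : NotCyclicallyAdjacent j k
    nonAdjacent = distance> (ℕₚ.m≤m+n 2 d) (s≤s z≤n)

    zeros-unique : Unique (j ∷ next j ∷ k ∷ next k ∷ [])
    zeros-unique =
      (next≢self 2≤m-1 j ∷ j≢k ∷ j≢qk ∷ []) ∷ (qj≢k ∷ qj≢qk ∷ []) ∷ (next≢self 2≤m-1 k ∷ []) ∷ [] ∷ []

    minus-ones-unique : Unique (j ∷ k ∷ [])
    minus-ones-unique = (j≢k ∷ []) ∷ [] ∷ []

    far-double-zero : 1 ≤ d → c j ≡ 0ℤ → c k ≡ 0ℤ → DoubleZero c
    far-double-zero 1≤d cj ck = j , k , nonAdjacent , cj , ck , inj₁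
      ( distance> (ℕₚ.+-monoʳ-≤ 2 1≤d) ℕₚ.≤-refl
      , Balanced⇒quiddity (c [ prev j ]+= c (next j) [ prev k ]+= c (next k)) (j ∷ next j ∷ k ∷ next k ∷ []) zeros-unique
          (far-zeros 2≤m-1 c bal j k j≢k j≢qk j≢pk qj≢k qj≢qk
            (pos-≢′ b qj pk (ℕₚ.+-monoʳ-≤ 2 1≤d) 2+d<m) pj≢k pj≢qk cj ck))

    far-double-minus-one : 1 ≤ d → c j ≡ -1ℤ → c k ≡ -1ℤ → DoubleMinusOne c
    far-double-minus-one 1≤d cj ck = j , k , nonAdjacent , cj , ck , inj₁
      ( distance> (ℕₚ.+-monoʳ-≤ 2 1≤d) ℕₚ.≤-refl
      , Balanced⇒quiddity (c [ prev j ]+= 1ℤ [ next j ]+= 1ℤ [ prev k ]+= 1ℤ [ next k ]+= 1ℤ) (j ∷ k ∷ []) minus-ones-unique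
          (far-minus-ones 2≤m-1 c bal j k j≢k qj≢k pj≢k j≢qk j≢pk cj ck))

  module _ (0<n : 0 < n) where

    near-double-zero : ∀ b → C (1 ℕ.+ b) ≡ 0ℤ → C (3 ℕ.+ b) ≡ 0ℤ → DoubleZero c
    near-double-zero b cj ck = j , k , nonAdjacent , cj , ck , inj₂
      ( trans qj (sym pk)
      , Balanced⇒quiddity (c [ prev j ]+= (c (next j) + c (next k))) (j ∷ next j ∷ k ∷ next k ∷ []) zeros-unique
          (near-zeros 2≤m-1 c bal j k (trans qj (sym pk)) j≢k j≢qk j≢pk qj≢k qj≢qk pj≢k pj≢qk cj ck))
      where open Pair b 0 0<n

    near-double-minus-one : ∀ b → C (1 ℕ.+ b) ≡ -1ℤ → C (3 ℕ.+ b) ≡ -1ℤ → DoubleMinusOne c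
    near-double-minus-one b cj ck = j , k , nonAdjacent , cj , ck , inj₂
      ( trans qj (sym pk)
      , Balanced⇒quiddity (c [ prev j ]+= 1ℤ [ next j ]+= (+ 2) [ next k ]+= 1ℤ) (j ∷ k ∷ []) minus-ones-unique
          (near-minus-ones 2≤m-1 c bal j k (trans qj (sym pk)) j≢k qj≢k pj≢k j≢qk j≢pk cj ck))
      where open Pair b 0 0<n

    -- Cyclic distance 2 occurs for d = 0, and for d = n with the two positions swapped.
    pair-cases : ∀ {P : Set} {v} →
      (∀ b → C (1 ℕ.+ b) ≡ v → C (3 ℕ.+ b) ≡ v → P) →
      (∀ b d → 1 ≤ d → d < n → C (1 ℕ.+ b) ≡ v → C (3 ℕ.+ d ℕ.+ b) ≡ v → P) →
      ∀ b d → d < suc n → C (1 ℕ.+ b) ≡ v → C (3 ℕ.+ d ℕ.+ b) ≡ v → P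
    pair-cases near far b zero    d≤n cj ck = near b cj ck
    pair-cases near far b (suc d) (s≤s d<n) cj ck with suc d ℕ.≟ n
    ... | no  d≢n  = far b (suc d) (s≤s z≤n) (ℕₚ.≤∧≢⇒< d<n d≢n) cj ck
    -- This base makes k the first position of the pair; the second one is then j, reached one full
    -- turn later.
    ... | yes refl = near (2 ℕ.+ n ℕ.+ b) ck
      (trans (cong c (trans (cong pos around) (pos-period (1 ℕ.+ b)))) cj)
      where
      around : 5 ℕ.+ n ℕ.+ b ≡ 1 ℕ.+ b ℕ.+ (4 ℕ.+ n)
      around = trans (sym (ℕₚ.+-suc (4 ℕ.+ n) b)) (ℕₚ.+-comm (4 ℕ.+ n) (suc b))

  -- The offset from j to k is 2 + d. As d runs from 0 to n it takes the values from 2 to m - 2 for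
  -- the length m, which are exactly the positions neither equal nor adjacent to j.
  record SmallPair : Set where
    field
      b d   : ℕ
      d≤n   : d < suc n
      smallⱼ : ∣ C (1 ℕ.+ b) ∣ < 2
      smallₖ : ∣ C (3 ℕ.+ d ℕ.+ b) ∣ < 2

  small-pair : SmallPair
  small-pair = record
    { b = b ; d = d ; d≤n = d≤n ; smallⱼ = smallⱼ
    ; smallₖ = subst (λ t → ∣ C t ∣ < 2)
        (trans (sym (ℕₚ.+-assoc d 3 b)) (cong (ℕ._+ b) (ℕₚ.+-comm d 3))) smallₖ }
    where
    first : ∃[ d ] (d < 2 ℕ.+ n × ∣ C (d ℕ.+ 1) ∣ < 2)
    -- The window consists of all letters except those at 0 and 3 + n, so its upper left entry is 1.
    first = small-entry C 1 (1 ℕ.+ n) (subst (_< 2)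
      (cong ∣_∣ (sym (proj₁ (middle-column C 0 (2 ℕ.+ n) (∏-cyclic 0))))) (s<s z<s))
    b = proj₁ first
    smallⱼ : ∣ C (1 ℕ.+ b) ∣ < 2
    smallⱼ = subst (λ t → ∣ C t ∣ < 2) (ℕₚ.+-comm b 1) (proj₂ (proj₂ first))
    second : ∃[ d ] (d < suc n × ∣ C (d ℕ.+ (3 ℕ.+ b)) ∣ < 2)
    -- The product starting right after j has lower left entry c_j; stripping its first letter makes
    -- this the upper left entry of the remaining window, which is therefore bounded by the
    -- smallness of c_j.
    second = small-entry C (3 ℕ.+ b) n (subst (_< 2)
      (cong ∣_∣ (trans (sym (proj₂ (middle-column C (1 ℕ.+ b) (2 ℕ.+ n) (∏-cyclic (1 ℕ.+ b)))))
        (e₂₁-η· (C (2 ℕ.+ b)) (∏ (just ∘ C) (3 ℕ.+ b) (1 ℕ.+ n))))) smallⱼ)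
    d = proj₁ second
    d≤n = proj₁ (proj₂ second)
    smallₖ = proj₂ (proj₂ second)

-- Choice of the reduction.

-- The upper left entry of η(0) η(a) η(0) η(b) is 1.
no-alternating-zeros : ∀ (c : Vector ℤ 4) → Balanced -1ℤ (masked c []) → ∀ b →
                       c (pos (1 ℕ.+ b)) ≡ 0ℤ → c (pos (3 ℕ.+ b)) ≢ 0ℤ
no-alternating-zeros c bal b cj ck = 1≢-1 (trans (sym corner) (cong e₁₁ product))
  where
  1≢-1 : 1ℤ ≢ -1ℤ
  1≢-1 ()
  C : ℕ → ℤ
  C t = c (pos t)
  x = C (2 ℕ.+ b)
  y = C (4 ℕ.+ b)
  product : η 0ℤ · (η x · (η 0ℤ · η y)) ≡ -I
  product = begin
    η 0ℤ · (η x · (η 0ℤ · η y))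
      ≡⟨ cong (λ M → η 0ℤ · (η x · (η 0ℤ · M))) (·-identityʳ (η y)) ⟨
    η 0ℤ · (η x · (η 0ℤ · (η y · I)))
      ≡⟨ cong₂ (λ p q → η p · (η x · (η q · (η y · I)))) cj ck ⟨
    ∏ (just ∘ C) (1 ℕ.+ b) 4
      ≡⟨ rotate (masked c []) (1 ℕ.+ b) (∏≡scalar bal) ⟩
    -I ∎
    where open ≡-Reasoning
  corner : e₁₁ (η 0ℤ · (η x · (η 0ℤ · η y))) ≡ 1ℤ
  corner = trans (cong (λ M → e₁₁ (η 0ℤ · M)) (η·η·η x 0ℤ y)) (e x y)
    where
    e : ∀ x y → 0ℤ * (x * 0ℤ * y + - x + - y) + -1ℤ * (0ℤ * y + -1ℤ) ≡ 1ℤ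
    e = solve-∀

-- Contracting a near pair uses five distinct positions from prev j to next k. In length 4 the pair
-- consists of opposite zeros, which a quiddity cycle cannot have.
double-zero : ∀ {n} (c : Vector ℤ (4 ℕ.+ n)) → Balanced -1ℤ (masked c []) → ∀ b d → d < suc n →
  c (pos (1 ℕ.+ b)) ≡ 0ℤ → c (pos (3 ℕ.+ d ℕ.+ b)) ≡ 0ℤ → DoubleZero c
double-zero {zero}  c bal b zero _ cj ck = contradiction ck (no-alternating-zeros c bal b cj)
double-zero {zero}  c bal b (suc d) (s≤s ())
double-zero {suc n} c bal = pair-cases c bal z<s (near-double-zero c bal z<s)
  λ b d 1≤d d<n → Pair.far-double-zero c bal b d d<n 1≤d

-- The parity hypothesis rules out length 4, so the five positions around a near pair are distinct.
double-minus-one : ∀ {n} (c : Vector ℤ (4 ℕ.+ n)) → Balanced -1ℤ (masked c []) → parity n ≡ 1ℙ →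
  ∀ b d → d < suc n → c (pos (1 ℕ.+ b)) ≡ -1ℤ → c (pos (3 ℕ.+ d ℕ.+ b)) ≡ -1ℤ → DoubleMinusOne c
double-minus-one {zero}  c bal ()
double-minus-one {suc n} c bal odd = pair-cases c bal z<s (near-double-minus-one c bal z<s)
  λ b d 1≤d d<n → Pair.far-double-minus-one c bal b d d<n 1≤d

-- An entry 1 among the two small ones is contracted at once. Otherwise a single 0 suffices in odd
-- length and a single -1 in even length; what is left is two zeros in even length or two entries -1
-- in odd length. Since `parity` recurses by two, the parity of the length 4 + n computes to
-- `parity n`.
some-reduction : ∀ {n} (c : Vector ℤ (4 ℕ.+ n)) → Balanced -1ℤ (masked c []) →
  SingleOne c ⊎ (parity n ≡ 1ℙ × SingleZero c) ⊎ (parity n ≡ 0ℙ × SingleMinusOne c) ⊎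
  DoubleZero c ⊎ DoubleMinusOne c
some-reduction {n} c bal =
  cases (small⇒-1,0,1 (c j) smallⱼ) (small⇒-1,0,1 (c k) smallₖ) (parity n) refl
  where
  open SmallPair (small-pair c bal)
  j k : Fin (4 ℕ.+ n)
  j = pos (1 ℕ.+ b)
  k = pos (3 ℕ.+ d ℕ.+ b)
  2≤m-1 : 2 ≤ 3 ℕ.+ n
  2≤m-1 = s≤s (s≤s z≤n)
  one : ∀ i → c i ≡ 1ℤ → SingleOne c
  one i ci = i , ci , single-one 2≤m-1 c bal i ci
  zero-odd : parity n ≡ 1ℙ → ∀ i → c i ≡ 0ℤ → SingleZero c
  zero-odd odd i ci = i , ci , single-zero 2≤m-1 c bal i ci odd
  minus-one-even : parity n ≡ 0ℙ → ∀ i → c i ≡ -1ℤ → SingleMinusOne c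
  -- The negated cycle has length 3 + n, which must be odd: its parity is opposite to that of n.
  minus-one-even even i ci = i , ci , single-minus-one 2≤m-1 c bal i ci
    (trans (sym (⁻¹-selfInverse (suc-homo-⁻¹ n))) (cong _⁻¹ even))
  cases : c j ≡ 1ℤ ⊎ c j ≡ 0ℤ ⊎ c j ≡ -1ℤ → c k ≡ 1ℤ ⊎ c k ≡ 0ℤ ⊎ c k ≡ -1ℤ → ∀ p → parity n ≡ p →
    SingleOne c ⊎ (parity n ≡ 1ℙ × SingleZero c) ⊎ (parity n ≡ 0ℙ × SingleMinusOne c) ⊎
    DoubleZero c ⊎ DoubleMinusOne c
  cases (inj₁ cj)        _                _  _    = inj₁ (one j cj)
  cases (inj₂ _)         (inj₁ ck)        _  _    = inj₁ (one k ck)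
  cases (inj₂ (inj₁ cj)) (inj₂ _)         1ℙ odd  = inj₂ (inj₁ (odd , zero-odd odd j cj))
  cases (inj₂ (inj₂ _))  (inj₂ (inj₁ ck)) 1ℙ odd  = inj₂ (inj₁ (odd , zero-odd odd k ck))
  cases (inj₂ (inj₂ cj)) (inj₂ _)         0ℙ even = inj₂ (inj₂ (inj₁ (even , minus-one-even even j cj)))
  cases (inj₂ (inj₁ _))  (inj₂ (inj₂ ck)) 0ℙ even = inj₂ (inj₂ (inj₁ (even , minus-one-even even k ck)))
  cases (inj₂ (inj₁ cj)) (inj₂ (inj₁ ck)) 0ℙ _    =
    inj₂ (inj₂ (inj₂ (inj₁ (double-zero c bal b d d≤n cj ck))))
  cases (inj₂ (inj₂ cj)) (inj₂ (inj₂ ck)) 1ℙ odd  =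
    inj₂ (inj₂ (inj₂ (inj₂ (double-minus-one c bal odd b d d≤n cj ck))))

-- Cycles of length less than four.

quiddity-2 : ∀ a b → IsQuiddityCycle (a ∷ b ∷ []) → _≡_ {A = List ℤ} (a ∷ b ∷ []) (0ℤ ∷ 0ℤ ∷ [])
quiddity-2 a b q = cong₂ (λ x y → x ∷ y ∷ []) a≡0 (cong e₂₁ eq)
  where
  eq : mat (a * b + -1ℤ) (- a) b -1ℤ ≡ -I
  eq = trans (sym (trans (cong (η a ·_) (·-identityʳ (η b))) (η·η a b))) q
  a≡0 : a ≡ 0ℤ
  a≡0 = ℤₚ.neg-injective (cong e₁₂ eq)

-- The lower right entry -b of the product fixes the middle letter as 1; the off-diagonal entries 1
-- - ab and bd - 1 then fix the other two.
quiddity-3 : ∀ a b d → IsQuiddityCycle (a ∷ b ∷ d ∷ []) →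
             _≡_ {A = List ℤ} (a ∷ b ∷ d ∷ []) (1ℤ ∷ 1ℤ ∷ 1ℤ ∷ [])
quiddity-3 a b d q = trans (cong₂ (λ x y → x ∷ y ∷ d ∷ []) a≡1 b≡1) (cong (λ z → 1ℤ ∷ 1ℤ ∷ z ∷ []) d≡1)
  where
  eq : mat (a * b * d + - a + - d) (1ℤ + - (a * b)) (b * d + -1ℤ) (- b) ≡ -I
  eq = trans (sym (trans (cong (λ M → η a · (η b · M)) (·-identityʳ (η d))) (η·η·η a b d))) q
  b≡1 : b ≡ 1ℤ
  b≡1 = ℤₚ.neg-injective (cong e₂₂ eq)
  a≡1 : a ≡ 1ℤ
  a≡1 = trans (trans (sym (ℤₚ.*-identityʳ a)) (cong (a *_) (sym b≡1))) (sym (ℤₚ.i-j≡0⇒i≡j 1ℤ (a * b) (cong e₁₂ eq)))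
  d≡1 : d ≡ 1ℤ
  d≡1 = trans (trans (sym (ℤₚ.*-identityˡ d)) (cong (_* d) (sym b≡1))) (ℤₚ.i-j≡0⇒i≡j (b * d) 1ℤ (cong e₂₁ eq))

theorem6p4 : (m : ℕ) (c : Vector ℤ m) → IsQuiddityCycle (toList c) →
    (m < 4 × (toList c ≡ 0ℤ ∷ 0ℤ ∷ [] ⊎ toList c ≡ 1ℤ ∷ 1ℤ ∷ 1ℤ ∷ []))
    ⊎ (∃[ k ] (c k ≡ 1ℤ ×
    IsQuiddityCycleOfLength (m ∸ 1)
    (c [ prev k ]+= -1ℤ [ next k ]+= -1ℤ omit (k ∷ []))))
    ⊎ (parity m ≡ 1ℙ × ∃[ k ] (c k ≡ 0ℤ ×
    IsQuiddityCycleOfLength (m ∸ 2)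
    (map -_ (c [ prev k ]+= c (next k) omit (k ∷ next k ∷ [])))))
    ⊎ (parity m ≡ 0ℙ × ∃[ k ] (c k ≡ -1ℤ ×
    IsQuiddityCycleOfLength (m ∸ 1)
    (map -_ (c [ prev k ]+= 1ℤ [ next k ]+= 1ℤ omit (k ∷ [])))))
    ⊎ (∃[ j ] ∃[ k ] (NotCyclicallyAdjacent j k × c j ≡ 0ℤ × c k ≡ 0ℤ ×
    ( (2 < cyclicDistance j k ×
    IsQuiddityCycleOfLength (m ∸ 4)
    (c [ prev j ]+= c (next j) [ prev k ]+= c (next k)
    omit (j ∷ next j ∷ k ∷ next k ∷ [])))
    ⊎ (next j ≡ prev k ×
    IsQuiddityCycleOfLength (m ∸ 4)
    (c [ prev j ]+= (c (next j) + c (next k))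
    omit (j ∷ next j ∷ k ∷ next k ∷ []))))))
    ⊎ (∃[ j ] ∃[ k ] (NotCyclicallyAdjacent j k × c j ≡ -1ℤ × c k ≡ -1ℤ ×
    ( (2 < cyclicDistance j k ×
    IsQuiddityCycleOfLength (m ∸ 2)
    (c [ prev j ]+= 1ℤ [ next j ]+= 1ℤ [ prev k ]+= 1ℤ [ next k ]+= 1ℤ
    omit (j ∷ k ∷ [])))
    ⊎ (next j ≡ prev k ×
    IsQuiddityCycleOfLength (m ∸ 2)
    (c [ prev j ]+= 1ℤ [ next j ]+= (+ 2) [ next k ]+= 1ℤ
    omit (j ∷ k ∷ []))))))
theorem6p4 0 c ()
-- A single letter has lower left entry 1, where -I has 0.
theorem6p4 1 c q = contradiction (cong e₂₁ q) (λ ())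
theorem6p4 2 c q = inj₁ (s≤s (s≤s (s≤s z≤n)) , inj₁ (quiddity-2 (c Fin.zero) (c (Fin.suc Fin.zero)) q))
theorem6p4 3 c q = inj₁ (s≤s (s≤s (s≤s (s≤s z≤n))) , inj₂ 
  (quiddity-3 (c Fin.zero) (c (Fin.suc Fin.zero)) (c (Fin.suc (Fin.suc Fin.zero))) q))
theorem6p4 (suc (suc (suc (suc n)))) c q = inj₂ (some-reduction c (quiddity⇒Balanced c q))
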